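{- The generating function of Motzkin N-bridges, $\sum_{w}x^{\min(w)}y^{\max(w)}t^{|w|}$ summed over all Motzkin N-bridges $w$, is algebraic.
   Context: An N-step is a non-empty finite set of integers. Motzkin N-walks are finite sequences $w=(s_1,\dots,s_n)$ of N-steps from $S_M=\{\{ -1\},\{0\},\{1\},\{ -1,0\},\{ -1,1\},\{0,1\},\{ -1,0,1\}\}$, starting at $0$; $|w|=n$. A classical walk $(v_1,\dots,v_n)$ of integers is compatible with $w$ if $v_i\in s_i$ for all $i$. The reachable points of $w$ are the endpoints $\sum_i v_i$ of all compatible walks; $\min(w)$ and $\max(w)$ are the smallest and largest reachable point. A Motzkin N-bridge is a Motzkin N-walk having $0$ as a reachable point. (Unweighted setting: every N-walk has weight $1$.) -}

module Defs where

open import Data.Nat as ℕ using (ℕ; zero; suc; _∸_; _≤_; _<_)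
open import Data.Integer as ℤ using (ℤ; +_; -_; _⊓_; _⊔_)
open import Data.List using (List; []; _∷_; map; concatMap; filter; length; foldr)
open import Data.List.Membership.Propositional using (_∈_)
open import Data.List.Membership.DecPropositional ℤ._≟_ using (_∈?_)
open import Data.Product using (_×_; Σ; ∃; ∃-syntax; _,_)
open import Data.Sum using (_⊎_)
open import Relation.Binary.PropositionalEquality using (_≡_; _≢_)
open import Relation.Nullary.Decidable using (_×-dec_)

-- Motzkin N-steps: the 7 non-empty subsets of {-1,0,1}

data MStep : Set where
  sM1 s0 sP1 sM10 sM1P1 s0P1 sM10P1 : MStep

elems : MStep → List ℤ
elems sM1    = - (+ 1) ∷ []
elems s0     = + 0 ∷ []
elems sP1    = + 1 ∷ []
elems sM10   = - (+ 1) ∷ + 0 ∷ []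
elems sM1P1  = - (+ 1) ∷ + 1 ∷ []
elems s0P1   = + 0 ∷ + 1 ∷ []
elems sM10P1 = - (+ 1) ∷ + 0 ∷ + 1 ∷ []

allSteps : List MStep
allSteps = sM1 ∷ s0 ∷ sP1 ∷ sM10 ∷ sM1P1 ∷ s0P1 ∷ sM10P1 ∷ []

NWalk : Set
NWalk = List MStep

allWalks : ℕ → List NWalk
allWalks zero    = [] ∷ []
allWalks (suc n) = concatMap (λ s → map (s ∷_) (allWalks n)) allSteps

compatible : NWalk → List (List ℤ)
compatible []      = [] ∷ []
compatible (s ∷ w) = concatMap (λ v → map (v ∷_) (compatible w)) (elems s)

sumℤ : List ℤ → ℤ
sumℤ = foldr ℤ._+_ (+ 0)

reachable : NWalk → List ℤ
reachable w = map sumℤ (compatible w)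

minimumℤ : List ℤ → ℤ
minimumℤ []       = + 0   -- never used: reachable w is non-empty
minimumℤ (x ∷ xs) = foldr _⊓_ x xs

maximumℤ : List ℤ → ℤ
maximumℤ []       = + 0   -- never used
maximumℤ (x ∷ xs) = foldr _⊔_ x xs

minW : NWalk → ℤ
minW w = minimumℤ (reachable w)

maxW : NWalk → ℤ
maxW w = maximumℤ (reachable w)

IsBridge : NWalk → Set
IsBridge w = + 0 ∈ reachable w

-- Formal power series in three variables X, y, t with integer coefficients:
-- f a b n is the coefficient of X^a y^b t^n.

Series : Set
Series = ℕ → ℕ → ℕ → ℤ

Σ≤ : ℕ → (ℕ → ℤ) → ℤ
Σ≤ zero    f = f zero
Σ≤ (suc n) f = Σ≤ n f ℤ.+ f (suc n)

_⊕_ : Series → Series → Series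
(f ⊕ g) a b n = f a b n ℤ.+ g a b n

_⊛_ : Series → Series → Series
(f ⊛ g) a b n =
  Σ≤ a λ i → Σ≤ b λ j → Σ≤ n λ k → f i j k ℤ.* g (a ∸ i) (b ∸ j) (n ∸ k)

zeroS : Series
zeroS _ _ _ = + 0

oneS : Series
oneS zero zero zero = + 1
oneS _    _    _    = + 0

_^S_ : Series → ℕ → Series
f ^S zero  = oneS
f ^S suc m = f ⊛ (f ^S m)

ΣS≤ : ℕ → (ℕ → Series) → Series
ΣS≤ zero    P = P zero
ΣS≤ (suc d) P = ΣS≤ d P ⊕ P (suc d)

IsPolynomial : Series → Set
IsPolynomial p = ∃[ D ] (∀ a b n → (D < a ⊎ D < b ⊎ D < n) → p a b n ≡ + 0)

IsAlgebraic : Series → Set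
IsAlgebraic F =
  Σ ℕ λ d → Σ (ℕ → Series) λ P →
    (∀ i → i ≤ d → IsPolynomial (P i))
    × (∃[ i ] ∃[ a ] ∃[ b ] ∃[ n ] (i ≤ d × P i a b n ≢ + 0))
    × (∀ a b n → ΣS≤ d (λ i → P i ⊛ (F ^S i)) a b n ≡ + 0)

-- The generating function Σ_w x^{min w} y^{max w} t^{|w|} over bridges,
-- written in X = 1/x (for bridges min w ≤ 0): the coefficient of
-- X^a y^b t^n is the number of bridges w with |w| = n, min w = -a, max w = b.

bridgeGF : Series
bridgeGF a b n =
  + length (filter (λ w → (+ 0 ∈? reachable w)
                          ×-dec (minW w ℤ.≟ - (+ a))
                          ×-dec (maxW w ℤ.≟ + b))
                   (allWalks n))

{-# OPTIONS --safe #-}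
module Submission where

-- The reachable set of an N-walk w is the whole interval [min w, max w] if w uses one of the steps
-- {-1,0}, {0,1}, {-1,0,1}, and otherwise {min w, min w + 2, ..., max w}. So among the walks with
-- min w = -a ≤ 0 ≤ b = max w all are bridges except those of the second kind with a odd, and
--   2 bridgeGF = 2 W - W₊ + W₋,
-- where W counts all walks and W± count those of the second kind with weights 1 and (-1)^a.
--
-- Each of the three is the part with a, b ≥ 0 of a series 1 / (1 - t S(X,y)) whose terms have a ≥ 0
-- or b ≥ 0. A step leaves or enters the quadrant only through the lines b = 0, a = 0, so the kernel
-- method expresses 2Xy (1 - t S) F through the one-dimensional series F₀(X), F₀(y) of the walks with
-- b = 0 and a = 0. These are inverse square roots of polynomials: one-dimensional walks with weights
-- p, q, r of the steps -1, 0, 1 return to 0 with generating function ((1 - q)² - 4pr)^(-1/2).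
--
-- Hence Q · bridgeGF is a sum of square roots of polynomials for some polynomial Q ≠ 0. If x
-- satisfies a monic equation and b² = δ is a polynomial, so does x + b: substituting x = (x + b) - b
-- gives A + b B = 0, that is A² - δ B² = 0. So Q · bridgeGF satisfies a monic equation of degree d,
-- and Q^d is the leading coefficient of one for bridgeGF.

open import Algebra.Bundles using (CommutativeRing)
open import Data.Integer as ℤ using (ℤ; +_; -[1+_])
import Data.Integer.Properties as ℤₚ
open import Data.Nat as ℕ using (ℕ; zero; suc; _∸_; z≤n; s≤s)
import Data.Nat.Properties as ℕₚ
open import Data.Product using (Σ; _×_; ∃-syntax; _,_)
open import Data.Sum using (_⊎_; inj₁; inj₂)
open import Function using (_∘_)
open import Level as Level using (_⊔_; 0ℓ)
open import Relation.Binary.PropositionalEquality as ≡ using (_≡_; _≢_)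
open import Defs

-- Integer coefficients for the ring solver

module IntegerCoefficients {c ℓ} (R : CommutativeRing c ℓ) where
  open import Data.Maybe.Base using (Maybe; map)
  open import Relation.Binary.Consequences using (dec⇒weaklyDec)
  open import Algebra.Solver.Ring.AlmostCommutativeRing
    using (fromCommutativeRing; _-Raw-AlmostCommutative⟶_)
  open CommutativeRing R
  open import Algebra.Properties.Ring ring
    using (-0#≈0#; -‿involutive; -‿distribˡ-*; -‿distribʳ-*; -‿+-comm)
  open import Algebra.Properties.Semiring.Mult.TCOptimised semiring
    using (×-homo-+; ×1-homo-*; 1+×) renaming (_×_ to _·_)
  open import Relation.Binary.Reasoning.Setoid setoid

  ⟦_⟧ℤ : ℤ → Carrier
  ⟦ + n ⟧ℤ      = n · 1#
  ⟦ -[1+ n ] ⟧ℤ = - (suc n · 1#)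

  cancel-1+ : ∀ a b → (1# + a) - (1# + b) ≈ a - b
  cancel-1+ a b = begin
    (1# + a) - (1# + b)     ≈⟨ +-cong (+-comm 1# a) (sym (-‿+-comm 1# b)) ⟩
    (a + 1#) + (- 1# - b)   ≈⟨ +-assoc a 1# (- 1# - b) ⟩
    a + (1# + (- 1# - b))   ≈⟨ +-congˡ (sym (+-assoc 1# (- 1#) (- b))) ⟩
    a + ((1# - 1#) - b)     ≈⟨ +-congˡ (+-congʳ (-‿inverseʳ 1#)) ⟩
    a + (0# - b)            ≈⟨ +-congˡ (+-identityˡ (- b)) ⟩
    a - b                   ∎

  -- Addition with mixed signs goes through `⊖`, whose recursion removes one unit from both sides;
  -- `cancel-1+` does the same in `R`.
  ⊖-homo : ∀ m n → ⟦ m ℤ.⊖ n ⟧ℤ ≈ m · 1# - n · 1#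
  ⊖-homo m       zero    = sym (trans (+-congˡ -0#≈0#) (+-identityʳ _))
  ⊖-homo zero    (suc n) = sym (+-identityˡ _)
  ⊖-homo (suc m) (suc n) = begin
    ⟦ suc m ℤ.⊖ suc n ⟧ℤ                ≡⟨ ≡.cong ⟦_⟧ℤ (ℤₚ.[1+m]⊖[1+n]≡m⊖n m n) ⟩
    ⟦ m ℤ.⊖ n ⟧ℤ                        ≈⟨ ⊖-homo m n ⟩
    m · 1# - n · 1#                   ≈⟨ sym (cancel-1+ _ _) ⟩
    (1# + m · 1#) - (1# + n · 1#)     ≈⟨ sym (+-cong (1+× m 1#) (-‿cong (1+× n 1#))) ⟩
    suc m · 1# - suc n · 1#           ∎

  +-homoℤ : ∀ i j → ⟦ i ℤ.+ j ⟧ℤ ≈ ⟦ i ⟧ℤ + ⟦ j ⟧ℤ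
  +-homoℤ (+ m)    (+ n)    = ×-homo-+ 1# m n
  +-homoℤ (+ m)    -[1+ n ] = ⊖-homo m (suc n)
  +-homoℤ -[1+ m ] (+ n)    = trans (⊖-homo n (suc m)) (+-comm _ _)
  +-homoℤ -[1+ m ] -[1+ n ] = begin
    - (suc (suc (m ℕ.+ n)) · 1#)      ≡⟨ ≡.cong (λ i → - (suc i · 1#)) (≡.sym (+-suc m n)) ⟩
    - ((suc m ℕ.+ suc n) · 1#)        ≈⟨ -‿cong (×-homo-+ 1# (suc m) (suc n)) ⟩
    - (suc m · 1# + suc n · 1#)       ≈⟨ sym (-‿+-comm _ _) ⟩
    - (suc m · 1#) - suc n · 1#       ∎
    where open import Data.Nat.Properties using (+-suc)

  -‿homoℤ : ∀ i → ⟦ ℤ.- i ⟧ℤ ≈ - ⟦ i ⟧ℤ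
  -‿homoℤ (+ zero)  = sym -0#≈0#
  -‿homoℤ (+ suc n) = refl
  -‿homoℤ -[1+ n ]  = sym (-‿involutive _)

  *-homo-+ : ∀ m j → ⟦ + m ℤ.* j ⟧ℤ ≈ ⟦ + m ⟧ℤ * ⟦ j ⟧ℤ
  *-homo-+ m (+ n) = trans (reflexive (≡.cong ⟦_⟧ℤ (≡.sym (ℤₚ.pos-* m n)))) (×1-homo-* m n)
  *-homo-+ m -[1+ n ] = begin
    ⟦ + m ℤ.* (ℤ.- + suc n) ⟧ℤ        ≡⟨ ≡.cong ⟦_⟧ℤ (≡.sym (ℤₚ.neg-distribʳ-* (+ m) (+ suc n))) ⟩
    ⟦ ℤ.- (+ m ℤ.* + suc n) ⟧ℤ        ≈⟨ -‿homoℤ (+ m ℤ.* + suc n) ⟩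
    - ⟦ + m ℤ.* + suc n ⟧ℤ            ≈⟨ -‿cong (*-homo-+ m (+ suc n)) ⟩
    - (⟦ + m ⟧ℤ * ⟦ + suc n ⟧ℤ)       ≈⟨ -‿distribʳ-* _ _ ⟩
    ⟦ + m ⟧ℤ * ⟦ -[1+ n ] ⟧ℤ          ∎

  *-homoℤ : ∀ i j → ⟦ i ℤ.* j ⟧ℤ ≈ ⟦ i ⟧ℤ * ⟦ j ⟧ℤ
  *-homoℤ (+ m)    j = *-homo-+ m j
  *-homoℤ -[1+ m ] j = begin
    ⟦ (ℤ.- + suc m) ℤ.* j ⟧ℤ          ≡⟨ ≡.cong ⟦_⟧ℤ (≡.sym (ℤₚ.neg-distribˡ-* (+ suc m) j)) ⟩
    ⟦ ℤ.- (+ suc m ℤ.* j) ⟧ℤ          ≈⟨ -‿homoℤ (+ suc m ℤ.* j) ⟩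
    - ⟦ + suc m ℤ.* j ⟧ℤ              ≈⟨ -‿cong (*-homo-+ (suc m) j) ⟩
    - (⟦ + suc m ⟧ℤ * ⟦ j ⟧ℤ)         ≈⟨ -‿distribˡ-* _ _ ⟩
    ⟦ -[1+ m ] ⟧ℤ * ⟦ j ⟧ℤ            ∎

  morphism : ℤ.+-*-rawRing -Raw-AlmostCommutative⟶ fromCommutativeRing R
  morphism = record
    { ⟦_⟧    = ⟦_⟧ℤ
    ; +-homo = +-homoℤ
    ; *-homo = *-homoℤ
    ; -‿homo = -‿homoℤ
    ; 0-homo = refl
    ; 1-homo = refl
    }

  -- Equality in `R` need not be decidable. Deciding it for integer coefficients lets the solver
  -- collect numerals and cancel opposite terms.
  coefficient≟ : ∀ i j → Maybe (⟦ i ⟧ℤ ≈ ⟦ j ⟧ℤ)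
  coefficient≟ i j =
    map (λ i≡j → reflexive (≡.cong ⟦_⟧ℤ i≡j)) (dec⇒weaklyDec ℤₚ._≟_ i j)

  open import Algebra.Solver.Ring ℤ.+-*-rawRing (fromCommutativeRing R) morphism coefficient≟ public
    using (solve; con; _:=_; _:+_; _:*_; _:-_; :-_)

-- Formal power series over a commutative ring

module PowerSeries {c ℓ} (R : CommutativeRing c ℓ) where
  import Algebra.Construct.Pointwise ℕ as Pointwise
  open CommutativeRing R
  open import Relation.Binary.Reasoning.Setoid setoid
  open import Algebra.Properties.CommutativeSemigroup +-commutativeSemigroup
    using (interchange; x∙yz≈y∙xz)

  PS : Set c
  PS = ℕ → Carrier

  infix 4 _≈ᴾ_
  infixl 7 _*ᴾ_

  _≈ᴾ_ : PS → PS → Set ℓ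
  f ≈ᴾ g = ∀ n → f n ≈ g n

  -- The Cauchy product, by a recursion that peels the constant term off the first factor. No index
  -- subtraction occurs, so the ring laws become plain inductions.
  _*ᴾ_ : PS → PS → PS
  (f *ᴾ g) zero    = f 0 * g 0
  (f *ᴾ g) (suc n) = f 0 * g (suc n) + ((f ∘ suc) *ᴾ g) n

  const : Carrier → PS
  const r zero    = r
  const r (suc n) = 0#

  shift : PS → PS
  shift f zero    = 0#
  shift f (suc n) = f n

  var : PS
  var = shift (const 1#)

  *ᴾ-cong : ∀ {f f′ g g′} → f ≈ᴾ f′ → g ≈ᴾ g′ → f *ᴾ g ≈ᴾ f′ *ᴾ g′
  *ᴾ-cong p q zero    = *-cong (p 0) (q 0)
  *ᴾ-cong p q (suc n) = +-cong (*-cong (p 0) (q (suc n))) (*ᴾ-cong (p ∘ suc) q n)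

  *ᴾ-distribˡ : ∀ f g h → f *ᴾ (λ n → g n + h n) ≈ᴾ (λ n → (f *ᴾ g) n + (f *ᴾ h) n)
  *ᴾ-distribˡ f g h zero    = distribˡ _ _ _
  *ᴾ-distribˡ f g h (suc n) =
    trans (+-cong (distribˡ _ _ _) (*ᴾ-distribˡ (f ∘ suc) g h n)) (interchange _ _ _ _)

  *ᴾ-distribʳ : ∀ f g h → (λ n → g n + h n) *ᴾ f ≈ᴾ (λ n → (g *ᴾ f) n + (h *ᴾ f) n)
  *ᴾ-distribʳ f g h zero    = distribʳ _ _ _
  *ᴾ-distribʳ f g h (suc n) =
    trans (+-cong (distribʳ _ _ _) (*ᴾ-distribʳ f (g ∘ suc) (h ∘ suc) n)) (interchange _ _ _ _)

  *ᴾ-scale : ∀ r f g → (λ n → r * f n) *ᴾ g ≈ᴾ (λ n → r * (f *ᴾ g) n)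
  *ᴾ-scale r f g zero    = *-assoc _ _ _
  *ᴾ-scale r f g (suc n) =
    trans (+-cong (*-assoc _ _ _) (*ᴾ-scale r (f ∘ suc) g n)) (sym (distribˡ _ _ _))

  *ᴾ-assoc : ∀ f g h → (f *ᴾ g) *ᴾ h ≈ᴾ f *ᴾ (g *ᴾ h)
  *ᴾ-assoc f g h zero    = *-assoc _ _ _
  *ᴾ-assoc f g h (suc n) = begin
    (f 0 * g 0) * h (suc n) + ((λ k → f 0 * g (suc k) + ((f ∘ suc) *ᴾ g) k) *ᴾ h) n
      ≈⟨ +-cong (*-assoc _ _ _) (*ᴾ-distribʳ h _ _ n) ⟩
    f 0 * (g 0 * h (suc n)) + (((λ k → f 0 * g (suc k)) *ᴾ h) n + (((f ∘ suc) *ᴾ g) *ᴾ h) n)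
      ≈⟨ +-congˡ (+-cong (*ᴾ-scale (f 0) (g ∘ suc) h n) (*ᴾ-assoc (f ∘ suc) g h n)) ⟩
    f 0 * (g 0 * h (suc n)) + (f 0 * ((g ∘ suc) *ᴾ h) n + ((f ∘ suc) *ᴾ (g *ᴾ h)) n)
      ≈⟨ sym (+-assoc _ _ _) ⟩
    (f 0 * (g 0 * h (suc n)) + f 0 * ((g ∘ suc) *ᴾ h) n) + ((f ∘ suc) *ᴾ (g *ᴾ h)) n
      ≈⟨ +-congʳ (sym (distribˡ _ _ _)) ⟩
    f 0 * (g *ᴾ h) (suc n) + ((f ∘ suc) *ᴾ (g *ᴾ h)) n ∎

  -- The recursion treats the factors asymmetrically; peeling the other end of the sum supplies the
  -- induction step for commutativity.
  *ᴾ-lastTerm : ∀ f g n → (f *ᴾ g) (suc n) ≈ f (suc n) * g 0 + (f *ᴾ (g ∘ suc)) n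
  *ᴾ-lastTerm f g zero    = +-comm _ _
  *ᴾ-lastTerm f g (suc n) = trans (+-congˡ (*ᴾ-lastTerm (f ∘ suc) g n)) (x∙yz≈y∙xz _ _ _)

  *ᴾ-comm : ∀ f g → f *ᴾ g ≈ᴾ g *ᴾ f
  *ᴾ-comm f g zero    = *-comm _ _
  *ᴾ-comm f g (suc n) =
    trans (+-cong (*-comm _ _) (*ᴾ-comm (f ∘ suc) g n)) (sym (*ᴾ-lastTerm g f n))

  *ᴾ-zeroˡ : ∀ f → (λ _ → 0#) *ᴾ f ≈ᴾ (λ _ → 0#)
  *ᴾ-zeroˡ f zero    = zeroˡ _
  *ᴾ-zeroˡ f (suc n) = trans (+-cong (zeroˡ _) (*ᴾ-zeroˡ f n)) (+-identityˡ _)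

  const-* : ∀ r f → const r *ᴾ f ≈ᴾ (λ n → r * f n)
  const-* r f zero    = refl
  const-* r f (suc n) = trans (+-congˡ (*ᴾ-zeroˡ f n)) (+-identityʳ _)

  *ᴾ-identityˡ : ∀ f → const 1# *ᴾ f ≈ᴾ f
  *ᴾ-identityˡ f n = trans (const-* 1# f n) (*-identityˡ _)

  shift-* : ∀ f g → shift f *ᴾ g ≈ᴾ shift (f *ᴾ g)
  shift-* f g zero    = zeroˡ _
  shift-* f g (suc n) = trans (+-congʳ (zeroˡ _)) (+-identityˡ _)

  shift-cong : ∀ {f g} → f ≈ᴾ g → shift f ≈ᴾ shift g
  shift-cong p zero    = refl
  shift-cong p (suc n) = p n

  var-* : ∀ f → var *ᴾ f ≈ᴾ shift f
  var-* f n = trans (shift-* (const 1#) f n) (shift-cong (*ᴾ-identityˡ f) n)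

  powerSeries : CommutativeRing c ℓ
  powerSeries = record
    { isCommutativeRing = record
      { isRing = record
        { +-isAbelianGroup = Pointwise.isAbelianGroup +-isAbelianGroup
        ; *-cong           = *ᴾ-cong
        ; *-assoc          = *ᴾ-assoc
        ; *-identity       = *ᴾ-identityˡ , λ f n → trans (*ᴾ-comm f _ n) (*ᴾ-identityˡ f n)
        ; distrib          = *ᴾ-distribˡ , *ᴾ-distribʳ
        }
      ; *-comm = *ᴾ-comm
      }
    }

-- Monic equations for sums of square roots

record Subring {c ℓ} (R : CommutativeRing c ℓ) p : Set (c ⊔ Level.suc p) where
  open CommutativeRing R
  field
    Poly     : Carrier → Set p
    Poly-0   : Poly 0#
    Poly-1   : Poly 1#
    Poly-+   : ∀ {f g} → Poly f → Poly g → Poly (f + g)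
    Poly-*   : ∀ {f g} → Poly f → Poly g → Poly (f * g)
    Poly-neg : ∀ {f} → Poly f → Poly (- f)

module Integrality {c ℓ p} (R : CommutativeRing c ℓ) (polynomials : Subring R p) where
  open CommutativeRing R
  open Subring polynomials
  open import Data.Nat.Properties using (+-suc)
  open import Relation.Binary.Reasoning.Setoid setoid
  open import Algebra.Properties.Ring ring using (-1*x≈-x)
  open IntegerCoefficients R

  -- Below u n v: v has degree < n in u; Monic u n v: v is monic of degree n in u.

  data Below (u : Carrier) : ℕ → Carrier → Set (c ⊔ ℓ ⊔ p) where
    nil  : ∀ {v} → v ≈ 0# → Below u 0 v
    cons : ∀ {n v q w} → Poly q → Below u n w → v ≈ q + u * w → Below u (suc n) v

  data Monic (u : Carrier) : ℕ → Carrier → Set (c ⊔ ℓ ⊔ p) where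
    nil  : ∀ {v} → v ≈ 1# → Monic u 0 v
    cons : ∀ {n v q w} → Poly q → Monic u n w → v ≈ q + u * w → Monic u (suc n) v

  Integral : Carrier → Set (c ⊔ ℓ ⊔ p)
  Integral u = ∃[ n ] Monic u n 0#

  module _ {u : Carrier} where

    Below-resp : ∀ {n v w} → v ≈ w → Below u n v → Below u n w
    Below-resp v≈w (nil e)      = nil (trans (sym v≈w) e)
    Below-resp v≈w (cons q b e) = cons q b (trans (sym v≈w) e)

    Monic-resp : ∀ {n v w} → v ≈ w → Monic u n v → Monic u n w
    Monic-resp v≈w (nil e)      = nil (trans (sym v≈w) e)
    Monic-resp v≈w (cons q b e) = cons q b (trans (sym v≈w) e)

    Below-u* : ∀ {n v} → Below u n v → Below u (suc n) (u * v)
    Below-u* b = cons Poly-0 b (sym (+-identityˡ _))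

    Below-0 : ∀ n → Below u n 0#
    Below-0 zero    = nil refl
    Below-0 (suc n) = Below-resp (zeroʳ u) (Below-u* (Below-0 n))

    Below-const : ∀ {q} n → Poly q → Below u (suc n) q
    Below-const n q = cons q (Below-0 n) (sym (trans (+-congˡ (zeroʳ u)) (+-identityʳ _)))

    Below-+ : ∀ {n v w} → Below u n v → Below u n w → Below u n (v + w)
    Below-+ (nil e) (nil f) = nil (trans (+-cong e f) (+-identityˡ _))
    Below-+ (cons {q = q} {w = v} p b e) (cons {q = r} {w = w} p′ b′ f) =
      cons (Poly-+ p p′) (Below-+ b b′) (trans (+-cong e f)
        (solve 5 (λ q r u v w → (q :+ u :* v) :+ (r :+ u :* w) := (q :+ r) :+ u :* (v :+ w))
          refl q r u v w))

    Monic-+ : ∀ {n v w} → Monic u n v → Below u n w → Monic u n (v + w)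
    Monic-+ (nil e) (nil f) = nil (trans (+-cong e f) (+-identityʳ _))
    Monic-+ (cons {q = q} {w = v} p b e) (cons {q = r} {w = w} p′ b′ f) =
      cons (Poly-+ p p′) (Monic-+ b b′) (trans (+-cong e f)
        (solve 5 (λ q r u v w → (q :+ u :* v) :+ (r :+ u :* w) := (q :+ r) :+ u :* (v :+ w))
          refl q r u v w))

    Monic-u* : ∀ {n v} → Monic u n v → Monic u (suc n) (u * v)
    Monic-u* b = cons Poly-0 b (sym (+-identityˡ _))

    Below-scale : ∀ {n v q} → Poly q → Below u n v → Below u n (q * v)
    Below-scale p (nil e) = nil (trans (*-congˡ e) (zeroʳ _))
    Below-scale {q = q} p (cons {q = r} {w = w} p′ b e) =
      cons (Poly-* p p′) (Below-scale p b) (trans (*-congˡ e)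
        (solve 4 (λ q r u w → q :* (r :+ u :* w) := q :* r :+ u :* (q :* w)) refl q r u w))

    Below-neg : ∀ {n v} → Below u n v → Below u n (- v)
    Below-neg b = Below-resp (-1*x≈-x _) (Below-scale (Poly-neg Poly-1) b)

    Below-suc : ∀ {n v} → Below u n v → Below u (suc n) v
    Below-suc (nil e)      = Below-resp (sym e) (Below-0 1)
    Below-suc (cons p b e) = cons p (Below-suc b) e

    Below-weaken : ∀ {m v} n → Below u m v → Below u (n ℕ.+ m) v
    Below-weaken zero    b = b
    Below-weaken (suc n) b = Below-suc (Below-weaken n b)

    Monic⇒Below : ∀ {n v} → Monic u n v → Below u (suc n) v
    Monic⇒Below (nil e)      = Below-resp (sym e) (Below-const 0 Poly-1)
    Monic⇒Below (cons p b e) = cons p (Monic⇒Below b) e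

    -- Multiplication in Horner form: the product with `v` reduces to the product with the shorter
    -- `x` and a scaling of `w`. Both `Below-*` and `Monic-*` recurse along it.
    *-expand : ∀ {v w q x} → v ≈ q + u * x → (u * (x * w)) + q * w ≈ v * w
    *-expand {v} {w} {q} {x} e = trans
      (solve 4 (λ w q x u → u :* (x :* w) :+ q :* w := (q :+ u :* x) :* w) refl w q x u)
      (*-congʳ (sym e))

    Below-* : ∀ {m n v w} → Below u m v → Below u n w → Below u (m ℕ.+ n) (v * w)
    Below-* {n = n} (nil e) b = Below-resp (sym (trans (*-congʳ e) (zeroˡ _))) (Below-0 n)
    Below-* {suc m} (cons p b e) b′ =
      Below-resp (*-expand e)
        (Below-+ (Below-u* (Below-* b b′)) (Below-weaken (suc m) (Below-scale p b′)))

    Monic-* : ∀ {m n v w} → Monic u m v → Monic u n w → Monic u (m ℕ.+ n) (v * w)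
    Monic-* (nil e) b = Monic-resp (sym (trans (*-congʳ e) (*-identityˡ _))) b
    Monic-* {suc m} {n} {w = w} (cons {q = q} p b e) b′ =
      Monic-resp (*-expand e) (Monic-+ (Monic-u* (Monic-* b b′))
        -- The scaled factor has degree at most `n`, hence lies below `m + suc n`; so it cannot
        -- disturb the leading term of degree `suc (m + n)`.
        (≡.subst (λ k → Below u k (q * w)) (+-suc m n)
          (Below-weaken m (Below-scale p (Monic⇒Below b′)))))

  -- Substituting x = w - b in a monic polynomial and reducing b² = δ leaves A + b B.
  Monic-substitute : ∀ {x b δ n v} → b * b ≈ δ → Poly δ → Monic x n v →
    ∃[ A ] ∃[ B ] Monic (x + b) n A × Below (x + b) n B × v ≈ A + b * B
  Monic-substitute {b = b} sq pδ (nil e) =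
    1# , 0# , nil refl , nil refl ,
    trans e (sym (trans (+-congˡ (zeroʳ b)) (+-identityʳ _)))
  Monic-substitute {x} {b} {δ} {suc n} {v} sq pδ (cons {q = q} {w = w} p m e)
    with A , B , mA , bB , eq ← Monic-substitute sq pδ m =
    -- These come from multiplying `A + b B` by `(x + b) - b`. As `B` has smaller degree than `A`,
    -- the correction `δ B` leaves the first component monic.
    (x + b) * A + (q - δ * B) , (x + b) * B - A ,
    Monic-+ (Monic-u* mA) (Below-+ (Below-const n p) (Below-suc (Below-neg (Below-scale pδ bB)))) ,
    Below-+ (Below-u* bB) (Below-neg (Monic⇒Below mA)) ,
    (begin
      v                       ≈⟨ e ⟩
      q + x * w               ≈⟨ +-congˡ (*-congˡ eq) ⟩
      q + x * (A + b * B)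
        ≈⟨ solve 5 (λ x b q A B → q :+ x :* (A :+ b :* B) :=
             ((x :+ b) :* A :+ (q :- (b :* b) :* B)) :+ b :* ((x :+ b) :* B :- A)) refl x b q A B ⟩
      ((x + b) * A + (q - (b * b) * B)) + b * ((x + b) * B - A)
        ≈⟨ +-congʳ (+-congˡ (+-congˡ (-‿cong (*-congʳ sq)))) ⟩
      ((x + b) * A + (q - δ * B)) + b * ((x + b) * B - A) ∎)

  -- The norm `A² - δ B² = (A + b B) (A - b B)` vanishes with its first factor. It is monic of
  -- degree `2n` in `x + b`, because `B` has degree below `n`.
  Integral-+√ : ∀ {x b δ} → b * b ≈ δ → Poly δ → Integral x → Integral (x + b)
  Integral-+√ {x} {b} {δ} sq pδ (n , m)
    with A , B , mA , bB , eq ← Monic-substitute sq pδ m =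
    n ℕ.+ n , Monic-resp norm (Monic-+ (Monic-* mA mA) (Below-neg (Below-scale pδ (Below-* bB bB))))
    where
    norm : A * A - δ * (B * B) ≈ 0#
    norm = begin
      A * A - δ * (B * B)             ≈⟨ +-congˡ (-‿cong (*-congʳ (sym sq))) ⟩
      A * A - (b * b) * (B * B)
        ≈⟨ solve 3 (λ A B b → A :* A :- (b :* b) :* (B :* B) := (A :+ b :* B) :* (A :- b :* B)) refl A B b ⟩
      (A + b * B) * (A - b * B)       ≈⟨ *-congʳ (sym eq) ⟩
      0# * (A - b * B)                ≈⟨ zeroˡ _ ⟩
      0#                              ∎

  Integral-0 : ∀ {x} → x ≈ 0# → Integral x
  Integral-0 {x} e = 1 , cons Poly-0 (nil refl)
    (sym (trans (+-identityˡ _) (trans (*-identityʳ _) e)))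

  -- Roots are adjoined one at a time, so integrality takes one use of `Integral-+√` per root.
  data RootSum : Carrier → Set (c ⊔ ℓ ⊔ p) where
    none : ∀ {u} → u ≈ 0# → RootSum u
    root : ∀ {u v b δ} → b * b ≈ δ → Poly δ → RootSum v → u ≈ v + b → RootSum u

  Integral-resp : ∀ {x y} → x ≈ y → Integral x → Integral y
  Integral-resp {x} {y} x≈y (n , m) = n , go m
    where
    go : ∀ {n v} → Monic x n v → Monic y n v
    go (nil e)      = nil e
    go (cons p m e) = cons p (go m) (trans e (+-congˡ (*-congʳ x≈y)))

  RootSum⇒Integral : ∀ {u} → RootSum u → Integral u
  RootSum⇒Integral (none e)          = Integral-0 e
  RootSum⇒Integral (root sq pδ r e)  =
    Integral-resp (sym e) (Integral-+√ sq pδ (RootSum⇒Integral r))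

  RootSum-resp : ∀ {u v} → u ≈ v → RootSum u → RootSum v
  RootSum-resp u≈v (none e)         = none (trans (sym u≈v) e)
  RootSum-resp u≈v (root sq pδ r e) = root sq pδ r (trans (sym u≈v) e)

  RootSum-+ : ∀ {u v} → RootSum u → RootSum v → RootSum (u + v)
  RootSum-+ r (none e) = RootSum-resp (sym (trans (+-congˡ e) (+-identityʳ _))) r
  RootSum-+ r (root sq pδ s e) =
    root sq pδ (RootSum-+ r s) (trans (+-congˡ e) (sym (+-assoc _ _ _)))

  RootSum-scale : ∀ {u q} → Poly q → RootSum u → RootSum (q * u)
  RootSum-scale p (none e) = none (trans (*-congˡ e) (zeroʳ _))
  RootSum-scale {q = q} p (root {b = b} sq pδ s e) =
    root
      (trans (solve 2 (λ q b → (q :* b) :* (q :* b) := (q :* q) :* (b :* b)) refl q b) (*-congˡ sq))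
      (Poly-* (Poly-* p p) pδ)
      (RootSum-scale p s)
      (trans (*-congˡ e) (distribˡ _ _ _))

  open import Algebra.Properties.Semiring.Exp semiring using (_^_; ^-homo-*)
  open import Algebra.Properties.CommutativeSemiring.Exp commutativeSemiring using (^-distrib-*)

  -- Peels off the first term, to match the Horner form of `Monic`; `Σ≤` and `ΣS≤` peel off the
  -- last.
  Σ≤ᴿ : ℕ → (ℕ → Carrier) → Carrier
  Σ≤ᴿ zero    f = f 0
  Σ≤ᴿ (suc n) f = f 0 + Σ≤ᴿ n (λ i → f (suc i))

  Σ≤ᴿ-cong : ∀ n {f g} → (∀ i → f i ≈ g i) → Σ≤ᴿ n f ≈ Σ≤ᴿ n g
  Σ≤ᴿ-cong zero    e = e 0
  Σ≤ᴿ-cong (suc n) e = +-cong (e 0) (Σ≤ᴿ-cong n (λ i → e (suc i)))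

  *-Σ≤ᴿ : ∀ n x f → x * Σ≤ᴿ n f ≈ Σ≤ᴿ n (λ i → x * f i)
  *-Σ≤ᴿ zero    x f = refl
  *-Σ≤ᴿ (suc n) x f = trans (distribˡ _ _ _) (+-congˡ (*-Σ≤ᴿ n x _))

  Monic⇒coefficients : ∀ {u n v} → Monic u n v →
    Σ (ℕ → Carrier) λ q → (∀ i → Poly (q i)) × q n ≡ 1# × v ≈ Σ≤ᴿ n (λ i → q i * u ^ i)
  Monic⇒coefficients (nil e) =
    (λ _ → 1#) , (λ _ → Poly-1) , ≡.refl , trans e (sym (*-identityʳ _))
  Monic⇒coefficients {u} {suc n} {v} (cons {q = q₀} p m e)
    with q , pq , q≡1 , eq ← Monic⇒coefficients m = q′ , pq′ , q≡1 , eq′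
    where
    q′ : ℕ → Carrier
    q′ zero    = q₀
    q′ (suc i) = q i
    pq′ : ∀ i → Poly (q′ i)
    pq′ zero    = p
    pq′ (suc i) = pq i
    eq′ : v ≈ Σ≤ᴿ (suc n) (λ i → q′ i * u ^ i)
    eq′ = trans e (+-cong (sym (*-identityʳ _))
      (trans (*-congˡ eq) (trans (*-Σ≤ᴿ n u _)
        (Σ≤ᴿ-cong n (λ i → solve 3 (λ u a b → u :* (a :* b) := a :* (u :* b)) refl u (q i) (u ^ i))))))

  -- Elements F with Q F a sum of square roots, where Q is θ^N modulo t; such Q are closed under
  -- products, which keeps the leading coefficient of the resulting equation nonzero.
  module Denominators (t θ : Carrier) where

    record SumOfRoots (F : Carrier) : Set (c ⊔ ℓ ⊔ p) where
      constructor sumOfRoots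
      field
        {denominator rest} : Carrier
        exponent  : ℕ
        poly      : Poly denominator
        leading   : denominator ≈ θ ^ exponent + t * rest
        isRootSum : RootSum (denominator * F)

    leading-* : ∀ m n {Q Q′ S S′} → Q ≈ θ ^ m + t * S → Q′ ≈ θ ^ n + t * S′ →
      Q * Q′ ≈ θ ^ (m ℕ.+ n) + t * (S * θ ^ n + θ ^ m * S′ + t * (S * S′))
    leading-* m n {S = S} {S′} e e′ = trans (*-cong e e′) (trans
      (solve 5 (λ a b t S S′ → (a :+ t :* S) :* (b :+ t :* S′) :=
         a :* b :+ t :* (S :* b :+ a :* S′ :+ t :* (S :* S′))) refl (θ ^ m) (θ ^ n) t S S′)
      (+-congʳ (sym (^-homo-* θ m n))))

    SumOfRoots-resp : ∀ {F F′} → F ≈ F′ → SumOfRoots F → SumOfRoots F′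
    SumOfRoots-resp e (sumOfRoots n p l r) = sumOfRoots n p l (RootSum-resp (*-congˡ e) r)

    SumOfRoots-+ : ∀ {F F′} → SumOfRoots F → SumOfRoots F′ → SumOfRoots (F + F′)
    SumOfRoots-+ {F} {F′} (sumOfRoots {Q} m p l r) (sumOfRoots {Q′} n p′ l′ r′) =
      sumOfRoots (m ℕ.+ n) (Poly-* p p′) (leading-* m n l l′)
        (RootSum-resp
          (solve 4 (λ Q Q′ F F′ → Q′ :* (Q :* F) :+ Q :* (Q′ :* F′) := (Q :* Q′) :* (F :+ F′))
            refl Q Q′ F F′)
          (RootSum-+ (RootSum-scale p′ r) (RootSum-scale p r′)))

    SumOfRoots-scale : ∀ {F q} → Poly q → SumOfRoots F → SumOfRoots (q * F)
    SumOfRoots-scale {F} {q} pq (sumOfRoots {Q} n p l r) = sumOfRoots n p l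
      (RootSum-resp (solve 3 (λ q Q F → q :* (Q :* F) := Q :* (q :* F)) refl q Q F)
        (RootSum-scale pq r))

    -- A factor `q` alone may spoil the shape `θ ^ n` of the denominator modulo `t`, so it is
    -- completed to `q w = θ`.
    SumOfRoots-divide : ∀ {F q w} → Poly q → Poly w → q * w ≈ θ → SumOfRoots (q * F) → SumOfRoots F
    SumOfRoots-divide {F} {q} {w} pq pw e (sumOfRoots {Q} {S} n p l r) =
      sumOfRoots (suc n) (Poly-* (Poly-* pq pw) p)
        (trans (*-cong e l)
          (solve 4 (λ θ a t S → θ :* (a :+ t :* S) := θ :* a :+ t :* (θ :* S)) refl θ (θ ^ n) t S))
        (RootSum-resp
          (solve 4 (λ q w Q F → w :* (Q :* (q :* F)) := q :* w :* Q :* F) refl q w Q F)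
          (RootSum-scale pw r))

    -- From (θ + t S) F = u f + v g with Δ f² = Δ′ g² = 1, multiplying by Δ Δ′ makes Δ f and Δ′ g,
    -- the square roots of Δ and Δ′, appear.
    fromInverseRoots : ∀ {F S u v f g Δ Δ′ S′ S″} →
      Poly θ → Poly t → Poly S → Poly u → Poly v → Poly Δ → Poly Δ′ →
      Δ ≈ 1# + t * S′ → Δ′ ≈ 1# + t * S″ → Δ * (f * f) ≈ 1# → Δ′ * (g * g) ≈ 1# →
      (θ + t * S) * F ≈ u * f + v * g → SumOfRoots F
    fromInverseRoots {F} {S} {u} {v} {f} {g} {Δ} {Δ′} pθ pt pS pu pv pΔ pΔ′ l l′ Δf² Δ′g² eq =
      -- The exponent is 1 because `Δ` and `Δ′` are 1 modulo `t`, so only `θ + t S` contributes a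
      -- `θ`.
      sumOfRoots 1 (Poly-* (Poly-+ pθ (Poly-* pt pS)) (Poly-* pΔ pΔ′))
        (leading-* 1 0 (+-congʳ (sym (*-identityʳ θ))) (leading-* 0 0 l l′))
        (RootSum-resp (sym split)
          (RootSum-+ (RootSum-scale (Poly-* pu pΔ′) (√ Δf² pΔ))
                     (RootSum-scale (Poly-* pv pΔ) (√ Δ′g² pΔ′))))
      where
      √ : ∀ {Δ f} → Δ * (f * f) ≈ 1# → Poly Δ → RootSum (Δ * f)
      √ {Δ} {f} e pΔ = root
        (trans (solve 2 (λ D f → (D :* f) :* (D :* f) := D :* (D :* (f :* f))) refl Δ f)
          (trans (*-congˡ e) (*-identityʳ Δ)))
        pΔ (none refl) (sym (+-identityˡ _))
      split : (θ + t * S) * (Δ * Δ′) * F ≈ (u * Δ′) * (Δ * f) + (v * Δ) * (Δ′ * g)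
      split = begin
        (θ + t * S) * (Δ * Δ′) * F
          ≈⟨ solve 4 (λ q D D′ F → q :* (D :* D′) :* F := (D :* D′) :* (q :* F)) refl (θ + t * S) Δ Δ′ F ⟩
        (Δ * Δ′) * ((θ + t * S) * F)     ≈⟨ *-congˡ eq ⟩
        (Δ * Δ′) * (u * f + v * g)
          ≈⟨ solve 6 (λ D D′ u f v g → (D :* D′) :* (u :* f :+ v :* g) :=
               (u :* D′) :* (D :* f) :+ (v :* D) :* (D′ :* g)) refl Δ Δ′ u f v g ⟩
        (u * Δ′) * (Δ * f) + (v * Δ) * (Δ′ * g) ∎

    leading-^ : ∀ n i {Q S} → Q ≈ θ ^ n + t * S → ∃[ S′ ] Q ^ i ≈ θ ^ (i ℕ.* n) + t * S′
    leading-^ n zero    e = 0# , sym (trans (+-congˡ (zeroʳ t)) (+-identityʳ 1#))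
    leading-^ n (suc i) e with S′ , e′ ← leading-^ n i e = _ , leading-* n (i ℕ.* n) e e′

    -- The monic equation of `Q F`, read as an equation for `F`, has coefficients `q i * Q ^ i`. The
    -- top one is `Q ^ d`, which is a power of `θ` modulo `t`; the equation is later shown to be
    -- nontrivial from this.
    equation : ∀ {F} → SumOfRoots F →
      ∃[ d ] ∃[ N ] Σ (ℕ → Carrier) λ P → (∀ i → Poly (P i)) ×
        (∃[ S ] P d ≈ θ ^ N + t * S) × Σ≤ᴿ d (λ i → P i * F ^ i) ≈ 0#
    equation {F} (sumOfRoots {Q} n p l r)
      with d , monic ← RootSum⇒Integral r
      with q , pq , q≡1 , eq ← Monic⇒coefficients monic
      with S , lead ← leading-^ n d l =
      d , d ℕ.* n , (λ i → q i * Q ^ i) , (λ i → Poly-* (pq i) (Poly-^ i)) ,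
      (S , trans (*-congʳ (reflexive q≡1)) (trans (*-identityˡ _) lead)) ,
      sym (trans eq (Σ≤ᴿ-cong d (λ i →
        trans (*-congˡ (^-distrib-* Q F i)) (sym (*-assoc _ _ _)))))
      where
      Poly-^ : ∀ i → Poly (Q ^ i)
      Poly-^ zero    = Poly-1
      Poly-^ (suc i) = Poly-* p (Poly-^ i)

-- The kernel method

module KernelMethod {c ℓ} (R : CommutativeRing c ℓ) where
  open CommutativeRing R
  open import Relation.Binary.Reasoning.Setoid setoid
  open import Algebra.Properties.Semiring.Exp semiring using (_^_)
  open import Algebra.Properties.Ring ring using (+-cancelʳ; x∙y⁻¹≈ε⇒x≈y)
  open IntegerCoefficients R

  -- Applied once per hypothesis, this reduces an equation to a ring identity.
  cancel-by : ∀ {L M l r} → l ≈ r → L + l ≈ M + r → L ≈ M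
  cancel-by {L} {M} {l} {r} l≈r e = +-cancelʳ l L M (trans e (+-congˡ (sym l≈r)))

  -- Separation of the `t`-adic topology: the powers of `t` have no common multiple except 0.
  Separated : Carrier → Set _
  Separated t = ∀ f → (∀ n → ∃[ g ] f ≈ (t ^ n) * g) → f ≈ 0#

  -- Substituting the recurrence into itself `n` times makes every `D i` divisible by `t ^ n`.
  -- Applied to differences, this is uniqueness of the solution of a recurrence.
  recurrence⇒0 : ∀ {i} {I : Set i} {t} → Separated t → (D a b c : I → Carrier) (α β γ : I → I) →
    (∀ i → D i ≈ t * (a i * D (α i) + b i * D (β i) + c i * D (γ i))) → ∀ i → D i ≈ 0#
  recurrence⇒0 {t = t} sep D a b c α β γ rec i = sep (D i) (λ n → divisible n i)
    where
    divisible : ∀ n i → ∃[ g ] D i ≈ (t ^ n) * g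
    divisible zero    i = D i , sym (*-identityˡ _)
    divisible (suc n) i
      with g₁ , e₁ ← divisible n (α i) | g₂ , e₂ ← divisible n (β i) | g₃ , e₃ ← divisible n (γ i) =
      a i * g₁ + b i * g₂ + c i * g₃ , (begin
        D i ≈⟨ rec i ⟩
        t * (a i * D (α i) + b i * D (β i) + c i * D (γ i))
          ≈⟨ *-congˡ (+-cong (+-cong (*-congˡ e₁) (*-congˡ e₂)) (*-congˡ e₃)) ⟩
        t * (a i * (t ^ n * g₁) + b i * (t ^ n * g₂) + c i * (t ^ n * g₃))
          ≈⟨ solve 8 (λ t T a b c x y z →
               t :* (a :* (T :* x) :+ b :* (T :* y) :+ c :* (T :* z)) :=
               (t :* T) :* (a :* x :+ b :* y :+ c :* z)) refl t (t ^ n) (a i) (b i) (c i) g₁ g₂ g₃ ⟩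
        (t * t ^ n) * (a i * g₁ + b i * g₂ + c i * g₃) ∎)

  -- One-dimensional walks with steps -1, 0, 1 of weights te, tq, tr: G j collects the walks from 0
  -- to j, and H k the walks from k to 0 that stay nonnegative.
  module Line (t e q r : Carrier) (separated : Separated t)
    (H : ℕ → Carrier)
    (H-zero : H 0 ≈ 1# + t * (q * H 0 + r * H 1))
    (H-suc : ∀ k → H (suc k) ≈ t * (e * H k + q * H (suc k) + r * H (suc (suc k))))
    (G : ℤ → Carrier)
    (G-zero : G (+ 0) ≈ 1# + t * (e * G (+ 1) + q * G (+ 0) + r * G -[1+ 0 ]))
    (G-pos : ∀ k → G (+ suc k) ≈ t * (e * G (+ suc (suc k)) + q * G (+ suc k) + r * G (+ k)))
    (G-neg : ∀ k → G -[1+ k ] ≈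
               t * (e * G (ℤ.suc -[1+ k ]) + q * G -[1+ k ] + r * G -[1+ suc k ]))
    where

    private
      two four : Carrier
      two  = 1# + 1#
      four = two + two

    -- The discriminant of the quadratic equation `M-quadratic` of `H 0`.
    discriminant : Carrier
    discriminant = (1# - t * q) * (1# - t * q) - four * (t * t * e * r)

    -- Cutting a walk at its first arrival at 0 leaves a walk that stays at height at least 1,
    -- counted by `H k`, one down step, and a walk counted by `H 0`. The proof checks that both
    -- sides satisfy the same recurrence.
    H-factor : ∀ k → H (suc k) ≈ t * e * H k * H 0
    H-factor k = x∙y⁻¹≈ε⇒x≈y _ _ (recurrence⇒0 separated D a (λ _ → q) (λ _ → r) ℕ.pred (λ k → k) suc rec k)
      where
      D a : ℕ → Carrier
      D k = H (suc k) - t * e * H k * H 0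
      -- For `k = 0` the downward term `t e H 0` cancels against the constant 1 in `H-zero`, so
      -- nothing is left for a predecessor; `ℕ.pred 0` is a placeholder.
      a zero    = 0#
      a (suc _) = e
      rec : ∀ k → D k ≈ t * (a k * D (ℕ.pred k) + q * D k + r * D (suc k))
      rec zero = trans (+-cong (H-suc 0) (-‿cong (*-congˡ H-zero)))
        (solve 7 (λ t e q r h₀ h₁ h₂ →
          t :* (e :* h₀ :+ q :* h₁ :+ r :* h₂)
            :- t :* e :* h₀ :* (con (+ 1) :+ t :* (q :* h₀ :+ r :* h₁)) :=
          t :* (con (+ 0) :* (h₁ :- t :* e :* h₀ :* h₀) :+ q :* (h₁ :- t :* e :* h₀ :* h₀)
            :+ r :* (h₂ :- t :* e :* h₁ :* h₀)))
          refl t e q r (H 0) (H 1) (H 2))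
      rec (suc k) = trans (+-cong (H-suc (suc k)) (-‿cong (*-congʳ (*-congˡ (H-suc k)))))
        (solve 9 (λ t e q r M h₀ h₁ h₂ h₃ →
          t :* (e :* h₁ :+ q :* h₂ :+ r :* h₃)
            :- t :* e :* (t :* (e :* h₀ :+ q :* h₁ :+ r :* h₂)) :* M :=
          t :* (e :* (h₁ :- t :* e :* h₀ :* M) :+ q :* (h₂ :- t :* e :* h₁ :* M)
            :+ r :* (h₃ :- t :* e :* h₂ :* M)))
          refl t e q r (H 0) (H k) (H (suc k)) (H (suc (suc k))) (H (suc (suc (suc k)))))

    private
      -- `U` and `V` are the ratios of `G` between neighbouring sites on the positive and on the
      -- negative side. `s` is the inverse of `G (+ 0)`: a return to 0 is a level step or an
      -- excursion to one of the sides, and the excursions of either side sum to `t t e r M`.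
      M s U V : Carrier
      M = H 0
      s = 1# - t * q - two * (t * t * e * r * M)
      U = t * r * M
      V = t * e * M

    M-quadratic : M ≈ 1# + t * (q * M + r * (t * e * M * M))
    M-quadratic = trans H-zero (+-congˡ (*-congˡ (+-congˡ (*-congˡ (H-factor 0)))))

    U-quadratic : U ≈ t * (e * (U * U) + q * U + r)
    U-quadratic = trans (*-congˡ M-quadratic)
      (solve 5 (λ t e q r M →
        t :* r :* (con (+ 1) :+ t :* (q :* M :+ r :* (t :* e :* M :* M))) :=
        t :* (e :* ((t :* r :* M) :* (t :* r :* M)) :+ q :* (t :* r :* M) :+ r)) refl t e q r M)

    V-quadratic : V ≈ t * (e + q * V + r * (V * V))
    V-quadratic = trans (*-congˡ M-quadratic)
      (solve 5 (λ t e q r M →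
        t :* e :* (con (+ 1) :+ t :* (q :* M :+ r :* (t :* e :* M :* M))) :=
        t :* (e :+ q :* (t :* e :* M) :+ r :* ((t :* e :* M) :* (t :* e :* M)))) refl t e q r M)

    private
      E : ℤ → Carrier
      E (+ k)    = U ^ k
      E -[1+ k ] = V ^ suc k

    -- Away from 0, the quadratic equations of `U` and `V` say that the geometric sequence `E` obeys
    -- the recurrence of `G`. At 0 its defect is exactly `s`, which matches `s` times the source 1
    -- of `G-zero`; the difference is thus homogeneous.
    sG≈E : ∀ j → s * G j ≈ E j
    sG≈E j = x∙y⁻¹≈ε⇒x≈y _ _ (recurrence⇒0 separated D (λ _ → e) (λ _ → q) (λ _ → r)
                     ℤ.suc (λ j → j) ℤ.pred rec j)
      where
      D : ℤ → Carrier
      D j = s * G j - E j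
      negative : ∀ {g₀ g₁ g₂} P → g₁ ≈ t * (e * g₀ + q * g₁ + r * g₂) →
        s * g₁ - V * P ≈ t * (e * (s * g₀ - P) + q * (s * g₁ - V * P) + r * (s * g₂ - V * (V * P)))
      negative {g₀} {g₁} {g₂} P g = trans (+-cong (*-congˡ g) (-‿cong (*-congʳ V-quadratic)))
        (solve 10 (λ t e q r s V P g₀ g₁ g₂ →
          s :* (t :* (e :* g₀ :+ q :* g₁ :+ r :* g₂)) :- t :* (e :+ q :* V :+ r :* (V :* V)) :* P :=
          t :* (e :* (s :* g₀ :- P) :+ q :* (s :* g₁ :- V :* P) :+ r :* (s :* g₂ :- V :* (V :* P))))
          refl t e q r s V P g₀ g₁ g₂)
      rec : ∀ j → D j ≈ t * (e * D (ℤ.suc j) + q * D j + r * D (ℤ.pred j))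
      rec (+ 0) = trans (+-congʳ (*-congˡ G-zero))
        (solve 8 (λ t e q r M g₋ g₀ g₊ →
          let s = con (+ 1) :- t :* q :- (con (+ 1) :+ con (+ 1)) :* (t :* t :* e :* r :* M) in
          s :* (con (+ 1) :+ t :* (e :* g₊ :+ q :* g₀ :+ r :* g₋)) :- con (+ 1) :=
          t :* (e :* (s :* g₊ :- (t :* r :* M) :* con (+ 1)) :+ q :* (s :* g₀ :- con (+ 1))
            :+ r :* (s :* g₋ :- (t :* e :* M) :* con (+ 1))))
          refl t e q r M (G -[1+ 0 ]) (G (+ 0)) (G (+ 1)))
      rec (+ suc k) = trans (+-cong (*-congˡ (G-pos k)) (-‿cong (*-congʳ U-quadratic)))
        (solve 10 (λ t e q r s U P g₀ g₁ g₂ →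
          s :* (t :* (e :* g₂ :+ q :* g₁ :+ r :* g₀)) :- t :* (e :* (U :* U) :+ q :* U :+ r) :* P :=
          t :* (e :* (s :* g₂ :- U :* (U :* P)) :+ q :* (s :* g₁ :- U :* P) :+ r :* (s :* g₀ :- P)))
          refl t e q r s U (U ^ k) (G (+ k)) (G (+ suc k)) (G (+ suc (suc k))))
      rec -[1+ zero ]  = negative (V ^ 0) (G-neg 0)
      rec -[1+ suc k ] = negative (V ^ suc k) (G-neg (suc k))

    -- Completing the square in `M-quadratic`, multiplied by `4 t² e r`.
    s²≈discriminant : s * s ≈ discriminant
    s²≈discriminant = cancel-by (*-congˡ {four * (t * t * e * r)} M-quadratic)
      (solve 5 (λ t e q r M →
        let one = con (+ 1)
            two = one :+ one
            four = two :+ two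
            s = one :- t :* q :- two :* (t :* t :* e :* r :* M) in
        s :* s :+ four :* (t :* t :* e :* r) :* M :=
        (one :- t :* q) :* (one :- t :* q) :- four :* (t :* t :* e :* r)
          :+ four :* (t :* t :* e :* r) :* (one :+ t :* (q :* M :+ r :* (t :* e :* M :* M))))
        refl t e q r M)

    discriminant-G₀² : discriminant * (G (+ 0) * G (+ 0)) ≈ 1#
    discriminant-G₀² = begin
      discriminant * (G (+ 0) * G (+ 0))    ≈⟨ *-congʳ (sym s²≈discriminant) ⟩
      s * s * (G (+ 0) * G (+ 0))
        ≈⟨ solve 2 (λ s g → s :* s :* (g :* g) := (s :* g) :* (s :* g)) refl s (G (+ 0)) ⟩
      s * G (+ 0) * (s * G (+ 0))           ≈⟨ *-cong (sG≈E (+ 0)) (sG≈E (+ 0)) ⟩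
      1# * 1#                               ≈⟨ *-identityˡ 1# ⟩
      1#                                    ∎

    -- The last step into 0 comes from either side with equal total weight, since `e U = r V`; each
    -- side thus contributes half of `(1 - t q) G₀ - 1`. Instead of dividing by `s`, the computation
    -- inserts the factor `s G₀ = 1`.
    G₋₁-from-G₀ : two * (t * (r * G -[1+ 0 ])) ≈ (1# - t * q) * G (+ 0) - 1#
    G₋₁-from-G₀ = begin
      two * (t * (r * g₋))                   ≈⟨ sym (*-identityʳ _) ⟩
      two * (t * (r * g₋)) * 1#              ≈⟨ *-congˡ (sym (sG≈E (+ 0))) ⟩
      two * (t * (r * g₋)) * (s * g₀)
        ≈⟨ solve 6 (λ w t r s g₋ g₀ →
             w :* (t :* (r :* g₋)) :* (s :* g₀) := w :* (t :* (r :* g₀)) :* (s :* g₋)) refl two t r s g₋ g₀ ⟩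
      two * (t * (r * g₀)) * (s * g₋)        ≈⟨ *-congˡ (sG≈E -[1+ 0 ]) ⟩
      two * (t * (r * g₀)) * (V * 1#)
        ≈⟨ solve 6 (λ t e q r M g →
             let one = con (+ 1) in
             (one :+ one) :* (t :* (r :* g)) :* (t :* e :* M :* one) :=
             (one :- t :* q) :* g
               :- (one :- t :* q :- (one :+ one) :* (t :* t :* e :* r :* M)) :* g) refl t e q r M g₀ ⟩
      (1# - t * q) * g₀ - s * g₀             ≈⟨ +-congˡ (-‿cong (sG≈E (+ 0))) ⟩
      (1# - t * q) * g₀ - 1#                 ∎
      where
      g₀ g₋ : Carrier
      g₀ = G (+ 0)
      g₋ = G -[1+ 0 ]

  -- F counts the walks ending in the quadrant; A and B are its divided differences in y and x.
  module Quadrant (t e m k x y F A B F₀ˣ F₀ʸ Vˣ Vʸ : Carrier)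
    (F-row : F ≈ F₀ˣ + y * A)
    (F-column : F ≈ F₀ʸ + x * B)
    (F-step : F ≈ 1# + t * (e * (x * A) + F + e * (y * B) + m * (x * F) + m * (y * F)
                            + k * (x * (y * F)) + (Vˣ + Vʸ)))
    (Vˣ-eq : (1# + 1#) * (t * Vˣ) ≈ (1# - t * (1# + m * x)) * F₀ˣ - 1#)
    (Vʸ-eq : (1# + 1#) * (t * Vʸ) ≈ (1# - t * (1# + m * y)) * F₀ʸ - 1#)
    where

    numerator : Carrier → Carrier → Carrier
    numerator u v = u * v * (1# - t * (1# + m * u)) - (1# + 1#) * (t * (e * (u * u)))

    stepPart : Carrier
    stepPart = - ((1# + 1#) * (e * (x * x) + x * y + e * (y * y) + m * (x * x * y) + m * (x * y * y)
                               + k * (x * x * y * y)))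

    -- Multiply `F-step` by `2 x y`. Then `A` occurs as `y A = F - F₀ˣ`, `B` as `x B = F - F₀ʸ`, and
    -- the boundary terms as `2 t Vˣ` and `2 t Vʸ`, all of which the hypotheses eliminate. The
    -- argument of each `*-congˡ` is the multiplier of its hypothesis.
    kernel-equation :
      ((1# + 1#) * (x * y) + t * stepPart) * F ≈ numerator x y * F₀ˣ + numerator y x * F₀ʸ
    kernel-equation =
      cancel-by (*-congˡ {two * (x * y)} (sym F-step))
      (cancel-by (*-congˡ {two * t * e * (x * x)} F-row)
      (cancel-by (*-congˡ {two * t * e * (y * y)} F-column)
      (cancel-by (*-congˡ {x * y} (sym Vˣ-eq))
      (cancel-by (*-congˡ {x * y} (sym Vʸ-eq))
      (solve 13 (λ t e m k x y F A B f g v w →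
        let one = con (+ 1)
            two = one :+ one
            num = λ u v → u :* v :* (one :- t :* (one :+ m :* u)) :- two :* (t :* (e :* (u :* u))) in
        (two :* (x :* y) :+ t :* (:- (two :* (e :* (x :* x) :+ x :* y :+ e :* (y :* y)
           :+ m :* (x :* x :* y) :+ m :* (x :* y :* y) :+ k :* (x :* x :* y :* y))))) :* F
         :+ two :* (x :* y) :* (one :+ t :* (e :* (x :* A) :+ F :+ e :* (y :* B) :+ m :* (x :* F)
              :+ m :* (y :* F) :+ k :* (x :* (y :* F)) :+ (v :+ w)))
         :+ two :* t :* e :* (x :* x) :* F
         :+ two :* t :* e :* (y :* y) :* F
         :+ x :* y :* ((one :- t :* (one :+ m :* x)) :* f :- one)
         :+ x :* y :* ((one :- t :* (one :+ m :* y)) :* g :- one) :=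
        num x y :* f :+ num y x :* g
         :+ two :* (x :* y) :* F
         :+ two :* t :* e :* (x :* x) :* (f :+ y :* A)
         :+ two :* t :* e :* (y :* y) :* (g :+ x :* B)
         :+ x :* y :* (two :* (t :* v))
         :+ x :* y :* (two :* (t :* w)))
        refl t e m k x y F A B F₀ˣ F₀ʸ Vˣ Vʸ)))))
      where
      two : Carrier
      two = 1# + 1#

-- Weighted counts of walks by minimum, maximum and length

indicator : ℤ → ℤ
indicator (+ 0) = + 1
indicator _     = + 0

δ : ℕ → ℕ → ℤ
δ 0 0 = + 1
δ _ _ = + 0

module Counting (e m k : ℤ) where
  open import Data.Integer.Base using (-[1+_]; _+_; _*_; _-_; -_; pred; 0ℤ; 1ℤ) renaming (suc to sucℤ)
  open import Data.Integer.Properties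
  open import Relation.Binary.PropositionalEquality
  open import Data.Integer.Solver using (module +-*-Solver)
  open +-*-Solver using (solve; con; _:=_; _:+_; _:*_; _:-_)
  open PowerSeries +-*-commutativeRing using (shift)
  open ≡-Reasoning

  -- Weighted number of walks of length n with minimum -a and maximum b: e is the weight of {-1} and
  -- {1}, m that of {-1,0} and {0,1}, and k the sum of those of {-1,1} and {-1,0,1}.
  count : ℕ → ℤ → ℤ → ℤ
  count zero    a b = indicator a * indicator b
  count (suc n) a b =
    e * count n (pred a) (sucℤ b) + count n a b + e * count n (sucℤ a) (pred b)
    + m * count n (pred a) b + m * count n a (pred b) + k * count n (pred a) (pred b)

  -- Negating all steps exchanges minimum and maximum and preserves the weights. This transfers
  -- results from one axis to the other.
  count-comm : ∀ n a b → count n a b ≡ count n b a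
  count-comm zero    a b = *-comm (indicator a) (indicator b)
  count-comm (suc n) a b
    rewrite count-comm n (pred a) (sucℤ b) | count-comm n a b | count-comm n (sucℤ a) (pred b)
          | count-comm n (pred a) b | count-comm n a (pred b) | count-comm n (pred a) (pred b) =
    solve 9 (λ e m k p q r s t u →
      e :* p :+ q :+ e :* r :+ m :* s :+ m :* t :+ k :* u :=
      e :* r :+ q :+ e :* p :+ m :* t :+ m :* s :+ k :* u) refl e m k _ _ _ _ _ _

  pred+ : ∀ {a b j} → a + b ≡ -[1+ j ] → pred a + b ≡ -[1+ suc j ]
  pred+ {a} {b} p = trans (+-assoc -[1+ 0 ] a b) (cong pred p)

  +pred : ∀ {a b j} → a + b ≡ -[1+ j ] → a + pred b ≡ -[1+ suc j ]
  +pred {a} {b} p = trans (+-pred a b) (cong pred p)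

  pred+suc : ∀ a b → pred a + sucℤ b ≡ a + b
  pred+suc = solve 2 (λ a b → (con -[1+ 0 ] :+ a) :+ (con 1ℤ :+ b) := a :+ b) refl

  suc+pred : ∀ a b → sucℤ a + pred b ≡ a + b
  suc+pred = solve 2 (λ a b → (con 1ℤ :+ a) :+ (con -[1+ 0 ] :+ b) := a :+ b) refl

  -- The width `a + b` starts at 0 and no step decreases it. This identifies the zeros that `shift`
  -- inserts with counts at negative width.
  count-support : ∀ n a b j → a + b ≡ -[1+ j ] → count n a b ≡ 0ℤ
  count-support zero (+ 0)     (+ 0)     j ()
  count-support zero (+ 0)     (+ suc b) j p = refl
  count-support zero (+ 0)     -[1+ b ]  j p = refl
  count-support zero (+ suc a) b         j p = refl
  count-support zero -[1+ a ]  b         j p = refl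
  count-support (suc n) a b j p
    rewrite count-support n (pred a) (sucℤ b) j (trans (pred+suc a b) p)
          | count-support n a b j p
          | count-support n (sucℤ a) (pred b) j (trans (suc+pred a b) p)
          | count-support n (pred a) b _ (pred+ {a} p)
          | count-support n a (pred b) _ (+pred {a} p)
          | count-support n (pred a) (pred b) _ (pred+ {a} (+pred {a} p)) =
    solve 3 (λ e m k → let o = con 0ℤ in
      e :* o :+ o :+ e :* o :+ m :* o :+ m :* o :+ k :* o := o) refl e m k

  -- Coordinates maximum j and width c = a + b, in which no step decreases the width.
  diagonal : ℤ → ℕ → ℕ → ℤ
  diagonal j c n = count n (+ c - j) j

  -- `stay` collects the steps that keep the maximum, `s0` and `sM10`; `rise` collects those that
  -- raise it, `sP1`, `s0P1`, `sM1P1` and `sM10P1`. Each `shift` records one unit of added width.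
  stay : (ℕ → ℤ) → ℕ → ℤ
  stay f c = f c + m * shift f c

  rise : (ℕ → ℤ) → ℕ → ℤ
  rise f c = e * f c + m * shift f c + k * shift (shift f) c

  shift-diagonal : ∀ j c n → shift (λ c → diagonal j c n) c ≡ count n (pred (+ c) - j) j
  shift-diagonal j zero    n =
    sym (count-support n _ j 0 (solve 1 (λ j → (con -[1+ 0 ] :- j) :+ j := con -[1+ 0 ]) refl j))
  shift-diagonal j (suc c) n = refl

  shift²-diagonal : ∀ j c n → shift (shift (λ c → diagonal j c n)) c ≡ count n (pred (pred (+ c)) - j) j
  shift²-diagonal j zero    n =
    sym (count-support n _ j 1 (solve 1 (λ j → (con -[1+ 1 ] :- j) :+ j := con -[1+ 1 ]) refl j))
  shift²-diagonal j (suc c) n = shift-diagonal j c n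

  rise-diagonal : ∀ j c n → rise (λ c → diagonal (pred j) c n) c ≡
    e * count n (sucℤ (+ c - j)) (pred j) + m * count n (+ c - j) (pred j)
    + k * count n (pred (+ c - j)) (pred j)
  rise-diagonal j c n
    rewrite shift-diagonal (pred j) c n | shift²-diagonal (pred j) c n
          | solve 2 (λ c j → c :- (con -[1+ 0 ] :+ j) := con 1ℤ :+ (c :- j)) refl (+ c) j
          | solve 2 (λ c j → (con -[1+ 0 ] :+ c) :- (con -[1+ 0 ] :+ j) := c :- j) refl (+ c) j
          | solve 2 (λ c j → (con -[1+ 0 ] :+ (con -[1+ 0 ] :+ c)) :- (con -[1+ 0 ] :+ j) :=
                             con -[1+ 0 ] :+ (c :- j)) refl (+ c) j = refl

  diagonal-suc : ∀ j c n → diagonal j c (suc n) ≡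
    e * diagonal (sucℤ j) c n + stay (λ c → diagonal j c n) c + rise (λ c → diagonal (pred j) c n) c
  diagonal-suc j c n
    rewrite rise-diagonal j c n | shift-diagonal j c n
          | solve 2 (λ c j → c :- (con 1ℤ :+ j) := con -[1+ 0 ] :+ (c :- j)) refl (+ c) j
          | solve 2 (λ c j → (con -[1+ 0 ] :+ c) :- j := con -[1+ 0 ] :+ (c :- j)) refl (+ c) j =
    solve 9 (λ e m k p q r s t u →
      e :* p :+ q :+ e :* r :+ m :* s :+ m :* t :+ k :* u :=
      e :* p :+ (q :+ m :* s) :+ (e :* r :+ m :* t :+ k :* u)) refl e m k _ _ _ _ _ _

  diagonal-zero : ∀ c → diagonal 0ℤ c 0 ≡ δ c 0
  diagonal-zero zero    = refl
  diagonal-zero (suc c) = refl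

  diagonal-zero-pos : ∀ j c → diagonal (+ suc j) c 0 ≡ 0ℤ
  diagonal-zero-pos j c = *-zeroʳ (indicator (+ c - + suc j))

  diagonal-zero-neg : ∀ j c → diagonal -[1+ j ] c 0 ≡ 0ℤ
  diagonal-zero-neg j c = *-zeroʳ (indicator (+ c - -[1+ j ]))

  -- Weighted number of walks of length n and width c from height j to 0 that stay nonnegative.
  meander : ℕ → ℕ → ℕ → ℤ
  meander zero    c zero    = δ c 0
  meander (suc j) c zero    = 0ℤ
  meander zero    c (suc n) =
    stay (λ c → meander 0 c n) c + rise (λ c → meander 1 c n) c
  meander (suc j) c (suc n) =
    e * meander j c n + stay (λ c → meander (suc j) c n) c
      + rise (λ c → meander (suc (suc j)) c n) c

-- One-dimensional series on the boundary of the quadrant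

open PowerSeries ℤₚ.+-*-commutativeRing using (shift)

-- em embeds the power series in z and t; K embeds the integers.
record Embedding {c ℓ} (R : CommutativeRing c ℓ) (t z : CommutativeRing.Carrier R) : Set (c ⊔ ℓ) where
  open CommutativeRing R
  field
    K       : ℤ → Carrier
    em      : (ℕ → ℕ → ℤ) → Carrier
    em-cong : ∀ {f g} → (∀ c n → f c n ≡ g c n) → em f ≈ em g
    em-+    : ∀ f g → em f + em g ≈ em (λ c n → f c n ℤ.+ g c n)
    K-em    : ∀ w f → K w * em f ≈ em (λ c n → w ℤ.* f c n)
    z-em    : ∀ f → z * em f ≈ em (λ c n → shift (λ c → f c n) c)
    t-em    : ∀ f → t * em f ≈ em (λ c → shift (f c))
    1-em    : 1# ≈ em δ

-- The width variable `z` is left abstract to treat both axes at once. Where the maximum is 0 the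
-- width is `a` and `z` is `x`; on the other axis `count-comm` exchanges the roles and `z` is `y`.
module Axis {c ℓ} (R : CommutativeRing c ℓ) (e m k : ℤ) (t z : CommutativeRing.Carrier R)
  (separated : KernelMethod.Separated R t) (embedding : Embedding R t z) where
  open CommutativeRing R
  open KernelMethod R using (module Line)
  open Counting e m k
  open Embedding embedding
  open import Relation.Binary.Reasoning.Setoid setoid
  open IntegerCoefficients R

  q r : Carrier
  q = 1# + K m * z
  r = K e + K m * z + K k * (z * z)

  G : ℤ → Carrier
  G j = em (diagonal j)

  private
    H : ℕ → Carrier
    H j = em (meander j)

    q-em : ∀ f → q * em f ≈ em (λ c n → stay (λ c → f c n) c)
    q-em f = begin
      (1# + K m * z) * em f
        ≈⟨ solve 3 (λ M z f → (con (+ 1) :+ M :* z) :* f := f :+ M :* (z :* f)) refl (K m) z (em f) ⟩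
      em f + K m * (z * em f)     ≈⟨ +-congˡ (trans (*-congˡ (z-em f)) (K-em m _)) ⟩
      em f + em _                 ≈⟨ em-+ f _ ⟩
      em _                        ∎

    r-em : ∀ f → r * em f ≈ em (λ c n → rise (λ c → f c n) c)
    r-em f = begin
      (K e + K m * z + K k * (z * z)) * em f
        ≈⟨ solve 5 (λ E M N z f → (E :+ M :* z :+ N :* (z :* z)) :* f :=
             E :* f :+ M :* (z :* f) :+ N :* (z :* (z :* f))) refl (K e) (K m) (K k) z (em f) ⟩
      K e * em f + K m * (z * em f) + K k * (z * (z * em f))
        ≈⟨ +-cong (+-cong (K-em e f) (trans (*-congˡ (z-em f)) (K-em m _)))
             (trans (*-congˡ (trans (*-congˡ (z-em f)) (z-em _))) (K-em k _)) ⟩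
      em _ + em _ + em _           ≈⟨ +-congʳ (em-+ _ _) ⟩
      em _ + em _                  ≈⟨ em-+ _ _ ⟩
      em _                         ∎

    step-em : ∀ f g h → t * (K e * em f + q * em g + r * em h) ≈
      em (λ c → shift (λ n → e ℤ.* f c n ℤ.+ stay (λ c → g c n) c ℤ.+ rise (λ c → h c n) c))
    step-em f g h = trans
      (*-congˡ (trans (+-cong (trans (+-cong (K-em e f) (q-em g)) (em-+ _ _)) (r-em h)) (em-+ _ _)))
      (t-em _)

    wall-em : ∀ g h → t * (q * em g + r * em h) ≈
      em (λ c → shift (λ n → stay (λ c → g c n) c ℤ.+ rise (λ c → h c n) c))
    wall-em g h = trans (*-congˡ (trans (+-cong (q-em g) (r-em h)) (em-+ _ _))) (t-em _)

    H-zero : H 0 ≈ 1# + t * (q * H 0 + r * H 1)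
    H-zero = sym (trans (+-cong 1-em (wall-em _ _)) (trans (em-+ _ _)
      (em-cong λ { c zero → ℤₚ.+-identityʳ _
                 ; zero (suc n) → ℤₚ.+-identityˡ _ ; (suc c) (suc n) → ℤₚ.+-identityˡ _ })))

    H-suc : ∀ j → H (suc j) ≈ t * (K e * H j + q * H (suc j) + r * H (suc (suc j)))
    H-suc j = sym (trans (step-em _ _ _) (em-cong λ { c zero → ≡.refl ; c (suc n) → ≡.refl }))

    G-zero : G (+ 0) ≈ 1# + t * (K e * G (+ 1) + q * G (+ 0) + r * G -[1+ 0 ])
    G-zero = trans (em-cong split) (sym (trans (+-cong 1-em (step-em _ _ _)) (em-+ _ _)))
      where
      split : ∀ c n → diagonal (+ 0) c n ≡ δ c n ℤ.+ shift (λ n → e ℤ.* diagonal (+ 1) c n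
        ℤ.+ stay (λ c → diagonal (+ 0) c n) c ℤ.+ rise (λ c → diagonal -[1+ 0 ] c n) c) n
      split c       zero    = ≡.trans (diagonal-zero c) (≡.sym (ℤₚ.+-identityʳ _))
      split zero    (suc n) = ≡.trans (diagonal-suc (+ 0) 0 n) (≡.sym (ℤₚ.+-identityˡ _))
      split (suc c) (suc n) = ≡.trans (diagonal-suc (+ 0) (suc c) n) (≡.sym (ℤₚ.+-identityˡ _))

    G-step : ∀ j → (∀ c → diagonal j c 0 ≡ + 0) →
      G j ≈ t * (K e * G (ℤ.suc j) + q * G j + r * G (ℤ.pred j))
    G-step j start = trans (em-cong λ { c zero → start c ; c (suc n) → diagonal-suc j c n })
      (sym (step-em _ _ _))

  open Line t (K e) q r separated H H-zero H-suc G G-zero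
    (λ j → G-step (+ suc j) (diagonal-zero-pos j)) (λ j → G-step -[1+ j ] (diagonal-zero-neg j))
    public using (discriminant; discriminant-G₀²; G₋₁-from-G₀)

  r-G₋₁ : r * G -[1+ 0 ] ≈ em (λ c n → rise (λ c → diagonal -[1+ 0 ] c n) c)
  r-G₋₁ = r-em (diagonal -[1+ 0 ])

open ≡ using (refl; sym; trans; cong; cong₂; subst)
open import Data.Bool using (Bool; true; false)
open import Data.Integer.Solver using (module +-*-Solver)
open import Data.List using (List; []; _∷_; _++_; map; concatMap; filter; length; foldr)
open import Data.List.Membership.DecPropositional ℤ._≟_ using (_∈?_)
open import Data.List.Membership.Propositional using (_∈_; find; lose)
open import Data.List.Membership.Propositional.Properties
  using (∈-map⁺; ∈-map⁻; ∈-concatMap⁺; ∈-concatMap⁻)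
open import Data.List.Relation.Unary.Any using (here; there)
open import Relation.Nullary using (Dec; yes; no; does; ¬_; contradiction)
open import Relation.Nullary.Decidable using (dec-true; dec-false; _×-dec_)
open import Relation.Unary using (Pred; Decidable)

-- Series in three variables

module T = PowerSeries ℤₚ.+-*-commutativeRing
module Y = PowerSeries T.powerSeries
module X = PowerSeries Y.powerSeries

-- The nesting order makes the carrier definitionally equal to `Series`, with `f a b n` as
-- coefficient.
seriesRing : CommutativeRing _ _
seriesRing = X.powerSeries

module S = CommutativeRing seriesRing

Σ≤-suc : ∀ n f → Σ≤ (suc n) f ≡ f 0 ℤ.+ Σ≤ n (f ∘ suc)
Σ≤-suc zero    f = refl
Σ≤-suc (suc n) f =
  trans (cong (ℤ._+ f (suc (suc n))) (Σ≤-suc n f)) (ℤₚ.+-assoc (f 0) _ _)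

Σ≤-cong : ∀ n {f g} → (∀ i → f i ≡ g i) → Σ≤ n f ≡ Σ≤ n g
Σ≤-cong zero    e = e 0
Σ≤-cong (suc n) e = cong₂ ℤ._+_ (Σ≤-cong n e) (e (suc n))

Σ≤-0 : ∀ n {f} → (∀ i → f i ≡ + 0) → Σ≤ n f ≡ + 0
Σ≤-0 zero    e = e 0
Σ≤-0 (suc n) e = cong₂ ℤ._+_ (Σ≤-0 n e) (e (suc n))

module _ {c ℓ} (R : CommutativeRing c ℓ) where
  open CommutativeRing R using (Carrier; _+_; _*_)

  -- `ev` reads off a coefficient in the inner variables. Being additive it moves inside the sum, so
  -- three uses turn the nested product into the triple sum of `⊛`.
  *ᴾ-Σ≤ : (ev : Carrier → ℤ) → (∀ u v → ev (u + v) ≡ ev u ℤ.+ ev v) →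
    ∀ f g n → ev (PowerSeries._*ᴾ_ R f g n) ≡ Σ≤ n (λ i → ev (f i * g (n ∸ i)))
  *ᴾ-Σ≤ ev ev-+ f g zero    = refl
  *ᴾ-Σ≤ ev ev-+ f g (suc n) = trans (ev-+ _ _)
    (trans (cong (λ z → ev (f 0 * g (suc n)) ℤ.+ z) (*ᴾ-Σ≤ ev ev-+ (f ∘ suc) g n))
      (sym (Σ≤-suc n _)))

⊛-* : ∀ f g → (f ⊛ g) S.≈ f S.* g
⊛-* f g a b n = sym
  (trans (*ᴾ-Σ≤ Y.powerSeries (λ h → h b n) (λ _ _ → refl) f g a)
    (Σ≤-cong a λ i → trans (*ᴾ-Σ≤ T.powerSeries (λ h → h n) (λ _ _ → refl) (f i) (g (a ∸ i)) b)
      (Σ≤-cong b λ j → *ᴾ-Σ≤ ℤₚ.+-*-commutativeRing (λ z → z) (λ _ _ → refl)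
        (f i j) (g (a ∸ i) (b ∸ j)) n)))

IsPolynomial-resp : ∀ {f g} → f S.≈ g → IsPolynomial f → IsPolynomial g
IsPolynomial-resp e (D , v) = D , λ a b n p → trans (sym (e a b n)) (v a b n p)

Outside : ℕ → ℕ → ℕ → ℕ → Set
Outside D a b n = D ℕ.< a ⊎ D ℕ.< b ⊎ D ℕ.< n

outside-+ˡ : ∀ {D E a b n} → Outside (D ℕ.+ E) a b n → Outside D a b n
outside-+ˡ {D} {E} (inj₁ p)        = inj₁ (ℕₚ.≤-<-trans (ℕₚ.m≤m+n D E) p)
outside-+ˡ {D} {E} (inj₂ (inj₁ p)) = inj₂ (inj₁ (ℕₚ.≤-<-trans (ℕₚ.m≤m+n D E) p))
outside-+ˡ {D} {E} (inj₂ (inj₂ p)) = inj₂ (inj₂ (ℕₚ.≤-<-trans (ℕₚ.m≤m+n D E) p))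

outside-+ʳ : ∀ {D E a b n} → Outside (D ℕ.+ E) a b n → Outside E a b n
outside-+ʳ {D} {E} rewrite ℕₚ.+-comm D E = outside-+ˡ

IsPolynomial-+ : ∀ {f g} → IsPolynomial f → IsPolynomial g → IsPolynomial (f S.+ g)
IsPolynomial-+ (D , u) (E , v) = D ℕ.+ E , λ a b n p →
  cong₂ ℤ._+_ (u a b n (outside-+ˡ p)) (v a b n (outside-+ʳ {D} p))

IsPolynomial-neg : ∀ {f} → IsPolynomial f → IsPolynomial (S.- f)
IsPolynomial-neg (D , u) = D , λ a b n p → cong ℤ.-_ (u a b n p)

exceeds-split : ∀ D E {a} i → D ℕ.+ E ℕ.< a → D ℕ.< i ⊎ E ℕ.< a ∸ i
exceeds-split D E {a} i p with D ℕₚ.<? i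
... | yes D<i = inj₁ D<i
... | no  D≮i = inj₂ (ℕₚ.m+n≤o⇒m≤o∸n (suc E)
  (ℕₚ.≤-trans (ℕ.s≤s (ℕₚ.≤-trans (ℕₚ.+-monoʳ-≤ E (ℕₚ.≮⇒≥ D≮i)) (ℕₚ.≤-reflexive (ℕₚ.+-comm E D)))) p))

IsPolynomial-* : ∀ {f g} → IsPolynomial f → IsPolynomial g → IsPolynomial (f S.* g)
IsPolynomial-* {f} {g} (D , u) (E , v) = IsPolynomial-resp (⊛-* f g) (D ℕ.+ E , λ a b n p →
  Σ≤-0 a λ i → Σ≤-0 b λ j → Σ≤-0 n λ l → term a b n i j l p)
  where
  first : ∀ {x y} → x ≡ + 0 → x ℤ.* y ≡ + 0
  first {y = y} e = trans (cong (ℤ._* y) e) (ℤₚ.*-zeroˡ y)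
  second : ∀ x {y} → y ≡ + 0 → x ℤ.* y ≡ + 0
  second x e = trans (cong (x ℤ.*_) e) (ℤₚ.*-zeroʳ x)
  term : ∀ a b n i j l → Outside (D ℕ.+ E) a b n →
    f i j l ℤ.* g (a ∸ i) (b ∸ j) (n ∸ l) ≡ + 0
  term a b n i j l (inj₁ p) with exceeds-split D E i p
  ... | inj₁ q = first (u i j l (inj₁ q))
  ... | inj₂ q = second (f i j l) (v _ _ _ (inj₁ q))
  term a b n i j l (inj₂ (inj₁ p)) with exceeds-split D E j p
  ... | inj₁ q = first (u i j l (inj₂ (inj₁ q)))
  ... | inj₂ q = second (f i j l) (v _ _ _ (inj₂ (inj₁ q)))
  term a b n i j l (inj₂ (inj₂ p)) with exceeds-split D E l p
  ... | inj₁ q = first (u i j l (inj₂ (inj₂ q)))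
  ... | inj₂ q = second (f i j l) (v _ _ _ (inj₂ (inj₂ q)))

x y t : Series
x = X.var
y = X.const Y.var
t = X.const (Y.const T.var)

K : ℤ → Series
K w = X.const (Y.const (T.const w))

x-* : ∀ f → x S.* f S.≈ X.shift f
x-* = X.var-*

y-* : ∀ f a b n → (y S.* f) a b n ≡ Y.shift (f a) b n
y-* f a b n = trans (X.const-* Y.var f a b n) (Y.var-* (f a) b n)

t-* : ∀ f a b n → (t S.* f) a b n ≡ shift (f a b) n
t-* f a b n = trans (X.const-* _ f a b n) (trans (Y.const-* T.var (f a) b n) (T.var-* (f a b) n))

K-* : ∀ w f a b n → (K w S.* f) a b n ≡ w ℤ.* f a b n
K-* w f a b n = trans (X.const-* _ f a b n) (trans (Y.const-* (T.const w) (f a) b n) (T.const-* w (f a b) n))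

IsPolynomial-K : ∀ w → IsPolynomial (K w)
IsPolynomial-K w = 0 , λ where
  (suc a) b       n       p → refl
  zero    (suc b) n       p → refl
  zero    zero    (suc n) p → refl
  zero    zero    zero    (inj₁ ())
  zero    zero    zero    (inj₂ (inj₁ ()))
  zero    zero    zero    (inj₂ (inj₂ ()))

IsPolynomial-0 : IsPolynomial S.0#
IsPolynomial-0 = 0 , λ _ _ _ _ → refl

IsPolynomial-1 : IsPolynomial S.1#
IsPolynomial-1 = IsPolynomial-K (+ 1)

IsPolynomial-x : IsPolynomial x
IsPolynomial-x = 1 , λ where
  zero          b       n       p → refl
  (suc (suc a)) b       n       p → refl
  (suc zero)    (suc b) n       p → refl
  (suc zero)    zero    (suc n) p → refl
  (suc zero)    zero    zero    (inj₁ (ℕ.s≤s ()))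
  (suc zero)    zero    zero    (inj₂ (inj₁ ()))
  (suc zero)    zero    zero    (inj₂ (inj₂ ()))

IsPolynomial-y : IsPolynomial y
IsPolynomial-y = 1 , λ where
  (suc a) b             n       p → refl
  zero    zero          n       p → refl
  zero    (suc (suc b)) n       p → refl
  zero    (suc zero)    (suc n) p → refl
  zero    (suc zero)    zero    (inj₁ ())
  zero    (suc zero)    zero    (inj₂ (inj₁ (ℕ.s≤s ())))
  zero    (suc zero)    zero    (inj₂ (inj₂ ()))

IsPolynomial-t : IsPolynomial t
IsPolynomial-t = 1 , λ where
  (suc a) b       n             p → refl
  zero    (suc b) n             p → refl
  zero    zero    zero          p → refl
  zero    zero    (suc (suc n)) p → refl
  zero    zero    (suc zero)    (inj₁ ())
  zero    zero    (suc zero)    (inj₂ (inj₁ ()))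
  zero    zero    (suc zero)    (inj₂ (inj₂ (ℕ.s≤s ())))

polynomials : Subring seriesRing 0ℓ
polynomials = record
  { Poly     = IsPolynomial
  ; Poly-0   = IsPolynomial-0
  ; Poly-1   = IsPolynomial-1
  ; Poly-+   = IsPolynomial-+
  ; Poly-*   = IsPolynomial-*
  ; Poly-neg = IsPolynomial-neg
  }

open import Algebra.Properties.Semiring.Exp S.semiring using (_^_)

t^-coefficient : ∀ {l n} g a b → n ℕ.< l → ((t ^ l) S.* g) a b n ≡ + 0
t^-coefficient {suc l} {n} g a b n<l =
  trans (S.*-assoc t (t ^ l) g a b n) (trans (t-* (t ^ l S.* g) a b n) (go n n<l))
  where
  go : ∀ n → n ℕ.< suc l → shift ((t ^ l S.* g) a b) n ≡ + 0
  go zero    _           = refl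
  go (suc n) (ℕ.s≤s n<l) = t^-coefficient {l} g a b n<l

-- Divisibility by `t ^ suc n` kills the coefficient of `t ^ n`.
t-separated : KernelMethod.Separated seriesRing t
t-separated f div a b n with g , e ← div (suc n) =
  trans (e a b n) (t^-coefficient {suc n} g a b ℕₚ.≤-refl)

-- θ = 2xy is the leading part at t = 0 of the denominator in the kernel equation.
θ : Series
θ = (S.1# S.+ S.1#) S.* (x S.* y)

-- The coefficient is `2 ^ N`, recorded only as a positive number. It doubles with each factor, and
-- `suc k + suc k` is `suc (k + suc k)`.
θ^-coefficient : ∀ N → ∃[ k ] (θ ^ N) N N 0 ≡ + suc k
θ^-coefficient zero    = 0 , refl
θ^-coefficient (suc N) with k , e ← θ^-coefficient N = k ℕ.+ suc k , trans step (cong₂ ℤ._+_ e e)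
  where
  expand : ∀ f → θ S.* f S.≈ x S.* (y S.* (f S.+ f))
  expand f =
    solve 3 (λ x y f → ((con (+ 1) :+ con (+ 1)) :* (x :* y)) :* f := x :* (y :* (f :+ f)))
      (λ _ _ _ → refl) x y f
    where
    open IntegerCoefficients seriesRing
  step : (θ ^ suc N) (suc N) (suc N) 0 ≡ (θ ^ N) N N 0 ℤ.+ (θ ^ N) N N 0
  step = trans (expand (θ ^ N) (suc N) (suc N) 0)
    (trans (x-* (y S.* (θ ^ N S.+ θ ^ N)) (suc N) (suc N) 0) (y-* (θ ^ N S.+ θ ^ N) N (suc N) 0))

open Integrality seriesRing polynomials
open Denominators t θ

-- Walks with minimum at most 0 and maximum at least 0

module QuadrantSeries (e m k : ℤ) where
  open Counting e m k

  quadrant : Series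
  quadrant a b n = count n (+ a) (+ b)

  private
    alongX alongY : (ℕ → ℕ → ℤ) → Series
    alongX f a = Y.const (f a)
    alongY     = X.const

    embeddingX : Embedding seriesRing t x
    embeddingX = record
      { K       = K
      ; em      = alongX
      ; em-cong = λ { p a zero n → p a n ; p a (suc b) n → refl }
      ; em-+    = λ { f g a zero n → refl ; f g a (suc b) n → refl }
      ; K-em    = λ { w f a zero n → K-* w (alongX f) a zero n
                    ; w f a (suc b) n → trans (K-* w (alongX f) a (suc b) n) (ℤₚ.*-zeroʳ w) }
      ; z-em    = λ f a b n → trans (x-* (alongX f) a b n) (shift-along f a b n)
      ; t-em    = λ f a b n → trans (t-* (alongX f) a b n) (t-along f a b n)
      ; 1-em    = λ { zero zero zero → refl ; zero zero (suc n) → refl ; zero (suc b) n → refl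
                    ; (suc a) zero n → refl ; (suc a) (suc b) n → refl }
      }
      where
      shift-along : ∀ f a b n → X.shift (alongX f) a b n ≡ alongX (λ c n → shift (λ c → f c n) c) a b n
      shift-along f zero    zero    n = refl
      shift-along f zero    (suc b) n = refl
      shift-along f (suc a) zero    n = refl
      shift-along f (suc a) (suc b) n = refl
      t-along : ∀ f a b n → shift (alongX f a b) n ≡ alongX (λ c → shift (f c)) a b n
      t-along f a zero    n       = refl
      t-along f a (suc b) zero    = refl
      t-along f a (suc b) (suc n) = refl

    embeddingY : Embedding seriesRing t y
    embeddingY = record
      { K       = K
      ; em      = alongY
      ; em-cong = λ { p zero b n → p b n ; p (suc a) b n → refl }
      ; em-+    = λ { f g zero b n → refl ; f g (suc a) b n → refl }
      ; K-em    = λ { w f zero b n → K-* w (alongY f) zero b n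
                    ; w f (suc a) b n → trans (K-* w (alongY f) (suc a) b n) (ℤₚ.*-zeroʳ w) }
      ; z-em    = λ f a b n → trans (y-* (alongY f) a b n) (shift-along f a b n)
      ; t-em    = λ f a b n → trans (t-* (alongY f) a b n) (t-along f a b n)
      ; 1-em    = λ { zero zero zero → refl ; zero zero (suc n) → refl ; zero (suc b) n → refl
                    ; (suc a) b n → refl }
      }
      where
      shift-along : ∀ f a b n → Y.shift (alongY f a) b n ≡ alongY (λ c n → shift (λ c → f c n) c) a b n
      shift-along f zero    zero    n = refl
      shift-along f zero    (suc b) n = refl
      shift-along f (suc a) zero    n = refl
      shift-along f (suc a) (suc b) n = refl
      t-along : ∀ f a b n → shift (alongY f a b) n ≡ alongY (λ c → shift (f c)) a b n
      t-along f zero    b n       = refl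
      t-along f (suc a) b zero    = refl
      t-along f (suc a) b (suc n) = refl

    module AxisX = Axis seriesRing e m k t x t-separated embeddingX
    module AxisY = Axis seriesRing e m k t y t-separated embeddingY

    diagonal-0 : ∀ c n → diagonal (+ 0) c n ≡ count n (+ c) (+ 0)
    diagonal-0 c n = cong (λ i → count n i (+ 0)) (ℤₚ.+-identityʳ (+ c))

    above right Vˣ Vʸ : Series
    above a b n = quadrant a (suc b) n
    right a b n = quadrant (suc a) b n
    Vˣ = AxisX.r S.* AxisX.G -[1+ 0 ]
    Vʸ = AxisY.r S.* AxisY.G -[1+ 0 ]

    row : quadrant S.≈ AxisX.G (+ 0) S.+ y S.* above
    row a zero    n = sym (trans (cong₂ ℤ._+_ (diagonal-0 a n) (y-* above a 0 n)) (ℤₚ.+-identityʳ _))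
    row a (suc b) n = sym (trans (cong (ℤ._+_ (+ 0)) (y-* above a (suc b) n)) (ℤₚ.+-identityˡ _))

    column : quadrant S.≈ AxisY.G (+ 0) S.+ x S.* right
    column zero    b n = sym (trans
      (cong₂ ℤ._+_ (trans (diagonal-0 b n) (count-comm n (+ b) (+ 0))) (x-* right 0 b n)) (ℤₚ.+-identityʳ _))
    column (suc a) b n = sym (trans (cong (ℤ._+_ (+ 0)) (x-* right (suc a) b n)) (ℤₚ.+-identityˡ _))

    -- The contributions to the line `b = 0` from `b = -1`, through the steps that raise the
    -- maximum. By `count-comm` the same values serve the line `a = 0`.
    entering : ℕ → ℕ → ℤ
    entering c n = e ℤ.* count n (+ suc c) -[1+ 0 ] ℤ.+ m ℤ.* count n (+ c) -[1+ 0 ]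
                   ℤ.+ k ℤ.* count n (ℤ.pred (+ c)) -[1+ 0 ]

    rise-entering : ∀ c n → rise (λ c → diagonal -[1+ 0 ] c n) c ≡ entering c n
    rise-entering c n = trans (rise-diagonal (+ 0) c n)
      (cong (λ i → e ℤ.* count n (ℤ.suc i) -[1+ 0 ] ℤ.+ m ℤ.* count n i -[1+ 0 ]
                   ℤ.+ k ℤ.* count n (ℤ.pred i) -[1+ 0 ]) (ℤₚ.+-identityʳ (+ c)))

    Vˣ-value : ∀ a b n → Vˣ a b n ≡ alongX entering a b n
    Vˣ-value a zero    n = trans (AxisX.r-G₋₁ a 0 n) (rise-entering a n)
    Vˣ-value a (suc b) n = AxisX.r-G₋₁ a (suc b) n

    Vʸ-value : ∀ a b n → Vʸ a b n ≡ alongY entering a b n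
    Vʸ-value zero    b n = trans (AxisY.r-G₋₁ 0 b n) (rise-entering b n)
    Vʸ-value (suc a) b n = AxisY.r-G₋₁ (suc a) b n

    xy-* : ∀ f a b n → (x S.* (y S.* f)) a b n ≡ X.shift (λ a → Y.shift (f a)) a b n
    xy-* f zero    b n = x-* (y S.* f) 0 b n
    xy-* f (suc a) b n = trans (x-* (y S.* f) (suc a) b n) (y-* f a b n)

    next : Series
    next = K e S.* (x S.* above) S.+ quadrant S.+ K e S.* (y S.* right) S.+ K m S.* (x S.* quadrant)
           S.+ K m S.* (y S.* quadrant) S.+ K k S.* (x S.* (y S.* quadrant)) S.+ (Vˣ S.+ Vʸ)

    next-value : ∀ a b n → next a b n ≡
      e ℤ.* X.shift above a b n ℤ.+ quadrant a b n ℤ.+ e ℤ.* Y.shift (right a) b n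
      ℤ.+ m ℤ.* X.shift quadrant a b n ℤ.+ m ℤ.* Y.shift (quadrant a) b n
      ℤ.+ k ℤ.* X.shift (λ a → Y.shift (quadrant a)) a b n
      ℤ.+ (alongX entering a b n ℤ.+ alongY entering a b n)
    next-value a b n =
      cong₂ ℤ._+_ (cong₂ ℤ._+_ (cong₂ ℤ._+_ (cong₂ ℤ._+_ (cong₂ ℤ._+_ (cong₂ ℤ._+_
        (scaled e (x S.* above) (x-* above a b n)) refl)
        (scaled e (y S.* right) (y-* right a b n)))
        (scaled m (x S.* quadrant) (x-* quadrant a b n)))
        (scaled m (y S.* quadrant) (y-* quadrant a b n)))
        (scaled k (x S.* (y S.* quadrant)) (xy-* quadrant a b n)))
        (cong₂ ℤ._+_ (Vˣ-value a b n) (Vʸ-value a b n))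
      where
      scaled : ∀ w f {v} → f a b n ≡ v → (K w S.* f) a b n ≡ w ℤ.* v
      scaled w f p = trans (K-* w f a b n) (cong (w ℤ.*_) p)

    -- Inside the quadrant the shifted series give all six terms of the recurrence. On an axis they
    -- drop the terms with a coordinate `-1`, and `Vˣ` or `Vʸ` restores these.
    count-suc : ∀ a b n → count (suc n) (+ a) (+ b) ≡ next a b n
    count-suc a b n = trans (cases a b) (sym (next-value a b n))
      where
      open +-*-Solver using (solve; con; _:=_; _:+_; _:*_)
      cases : ∀ a b → count (suc n) (+ a) (+ b) ≡
        e ℤ.* X.shift above a b n ℤ.+ quadrant a b n ℤ.+ e ℤ.* Y.shift (right a) b n
        ℤ.+ m ℤ.* X.shift quadrant a b n ℤ.+ m ℤ.* Y.shift (quadrant a) b n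
        ℤ.+ k ℤ.* X.shift (λ a → Y.shift (quadrant a)) a b n
        ℤ.+ (alongX entering a b n ℤ.+ alongY entering a b n)
      -- At the corner both boundary terms include the predecessor `(-1, -1)`; the double counting
      -- is harmless because its width is negative and its count 0.
      cases zero zero
        rewrite count-comm n -[1+ 0 ] (+ 1) | count-comm n -[1+ 0 ] (+ 0)
              | count-support n -[1+ 0 ] -[1+ 0 ] _ refl =
        solve 6 (λ e m k p q r →
          e :* p :+ q :+ e :* p :+ m :* r :+ m :* r :+ k :* con (+ 0) :=
          e :* con (+ 0) :+ q :+ e :* con (+ 0) :+ m :* con (+ 0) :+ m :* con (+ 0) :+ k :* con (+ 0)
            :+ ((e :* p :+ m :* r :+ k :* con (+ 0)) :+ (e :* p :+ m :* r :+ k :* con (+ 0))))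
          refl e m k _ _ _
      cases zero (suc b)
        rewrite count-comm n -[1+ 0 ] (+ suc (suc b)) | count-comm n -[1+ 0 ] (+ suc b)
              | count-comm n -[1+ 0 ] (+ b) =
        solve 9 (λ e m k p q r s t u →
          e :* p :+ q :+ e :* r :+ m :* s :+ m :* t :+ k :* u :=
          e :* con (+ 0) :+ q :+ e :* r :+ m :* con (+ 0) :+ m :* t :+ k :* con (+ 0)
            :+ (con (+ 0) :+ (e :* p :+ m :* s :+ k :* u)))
          refl e m k _ _ _ _ _ _
      cases (suc a) zero =
        solve 9 (λ e m k p q r s t u →
          e :* p :+ q :+ e :* r :+ m :* s :+ m :* t :+ k :* u :=
          e :* p :+ q :+ e :* con (+ 0) :+ m :* s :+ m :* con (+ 0) :+ k :* con (+ 0)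
            :+ ((e :* r :+ m :* t :+ k :* u) :+ con (+ 0)))
          refl e m k _ _ _ _ _ _
      cases (suc a) (suc b) =
        solve 9 (λ e m k p q r s t u →
          e :* p :+ q :+ e :* r :+ m :* s :+ m :* t :+ k :* u :=
          e :* p :+ q :+ e :* r :+ m :* s :+ m :* t :+ k :* u :+ (con (+ 0) :+ con (+ 0)))
          refl e m k _ _ _ _ _ _

    step : quadrant S.≈ S.1# S.+ t S.* next
    step a b zero = sym (trans (cong (ℤ._+_ (S.1# a b 0)) (t-* next a b 0)) (start a b))
      where
      start : ∀ a b → S.1# a b 0 ℤ.+ + 0 ≡ quadrant a b 0
      start zero    zero    = refl
      start zero    (suc b) = refl
      start (suc a) b       = refl
    step a b (suc n) = sym (trans (cong₂ ℤ._+_ (one a b) (t-* next a b (suc n)))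
      (trans (ℤₚ.+-identityˡ _) (sym (count-suc a b n))))
      where
      one : ∀ a b → S.1# a b (suc n) ≡ + 0
      one zero    zero    = refl
      one zero    (suc b) = refl
      one (suc a) b       = refl

    open KernelMethod.Quadrant seriesRing t (K e) (K m) (K k) x y
      quadrant above right (AxisX.G (+ 0)) (AxisY.G (+ 0)) Vˣ Vʸ
      row column step AxisX.G₋₁-from-G₀ AxisY.G₋₁-from-G₀

  sumOfRoots-quadrant : SumOfRoots quadrant
  sumOfRoots-quadrant = fromInverseRoots
    polyθ IsPolynomial-t polyStep (polyNumerator IsPolynomial-x IsPolynomial-y)
    (polyNumerator IsPolynomial-y IsPolynomial-x)
    (polyDiscriminant IsPolynomial-x) (polyDiscriminant IsPolynomial-y)
    (leading x) (leading y) AxisX.discriminant-G₀² AxisY.discriminant-G₀² kernel-equation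
    where
    open IntegerCoefficients seriesRing
    _⊕ᵖ_ = IsPolynomial-+
    _⊛ᵖ_ = IsPolynomial-*
    infixl 6 _⊕ᵖ_
    infixl 7 _⊛ᵖ_
    one = S.1#
    two = one S.+ one
    poly1 = IsPolynomial-1
    poly2 : IsPolynomial two
    poly2 = poly1 ⊕ᵖ poly1
    px = IsPolynomial-x
    py = IsPolynomial-y
    pt = IsPolynomial-t
    pK = IsPolynomial-K
    polyθ : IsPolynomial θ
    polyθ = poly2 ⊛ᵖ (px ⊛ᵖ py)
    polyStep : IsPolynomial stepPart
    polyStep = IsPolynomial-neg (poly2 ⊛ᵖ (pK e ⊛ᵖ (px ⊛ᵖ px) ⊕ᵖ px ⊛ᵖ py ⊕ᵖ pK e ⊛ᵖ (py ⊛ᵖ py)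
      ⊕ᵖ pK m ⊛ᵖ (px ⊛ᵖ px ⊛ᵖ py) ⊕ᵖ pK m ⊛ᵖ (px ⊛ᵖ py ⊛ᵖ py) ⊕ᵖ pK k ⊛ᵖ (px ⊛ᵖ px ⊛ᵖ py ⊛ᵖ py)))
    polyNumerator : ∀ {u v} → IsPolynomial u → IsPolynomial v → IsPolynomial (numerator u v)
    polyNumerator pu pv =
      pu ⊛ᵖ pv ⊛ᵖ (poly1 ⊕ᵖ IsPolynomial-neg (pt ⊛ᵖ (poly1 ⊕ᵖ pK m ⊛ᵖ pu)))
      ⊕ᵖ IsPolynomial-neg (poly2 ⊛ᵖ (pt ⊛ᵖ (pK e ⊛ᵖ (pu ⊛ᵖ pu))))
    -- The discriminants of the two axes as one function of the width variable, so that
    -- polynomiality and the constant term 1 modulo `t` are proved once.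
    disc : Series → Series
    disc z = (one S.- t S.* (one S.+ K m S.* z)) S.* (one S.- t S.* (one S.+ K m S.* z))
      S.- (two S.+ two) S.* (t S.* t S.* K e S.* (K e S.+ K m S.* z S.+ K k S.* (z S.* z)))
    polyDiscriminant : ∀ {z} → IsPolynomial z → IsPolynomial (disc z)
    polyDiscriminant pz = pa ⊛ᵖ pa ⊕ᵖ IsPolynomial-neg ((poly2 ⊕ᵖ poly2)
      ⊛ᵖ (pt ⊛ᵖ pt ⊛ᵖ pK e ⊛ᵖ (pK e ⊕ᵖ pK m ⊛ᵖ pz ⊕ᵖ pK k ⊛ᵖ (pz ⊛ᵖ pz))))
      where pa = poly1 ⊕ᵖ IsPolynomial-neg (pt ⊛ᵖ (poly1 ⊕ᵖ pK m ⊛ᵖ pz))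
    leading : ∀ z → disc z S.≈ one S.+ t S.* _
    leading z = solve 4 (λ t q e r →
        let one = con (+ 1)
            two = one :+ one in
        (one :- t :* q) :* (one :- t :* q) :- (two :+ two) :* (t :* t :* e :* r) :=
        one :+ t :* (t :* q :* q :- two :* q :- (two :+ two) :* (t :* e :* r)))
      (λ _ _ _ → refl) t (one S.+ K m S.* z) (K e) (K e S.+ K m S.* z S.+ K k S.* (z S.* z))

-- Reachable sets of N-walks

open +-*-Solver using (solve; con; _:=_; _:+_; _:*_; _:-_; :-_)

low : MStep → ℤ
low sM1    = -[1+ 0 ]
low s0     = + 0
low sP1    = + 1
low sM10   = -[1+ 0 ]
low sM1P1  = -[1+ 0 ]
low s0P1   = + 0
low sM10P1 = -[1+ 0 ]

-- Minus the largest element, so that prepending a step adds to both coordinates.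
neghigh : MStep → ℤ
neghigh sM1    = + 1
neghigh s0     = + 0
neghigh sP1    = -[1+ 0 ]
neghigh sM10   = + 0
neghigh sM1P1  = -[1+ 0 ]
neghigh s0P1   = -[1+ 0 ]
neghigh sM10P1 = -[1+ 0 ]

lower neghigher : NWalk → ℤ
lower []      = + 0
lower (s ∷ w) = low s ℤ.+ lower w
neghigher []      = + 0
neghigher (s ∷ w) = neghigh s ℤ.+ neghigher w

-- The reachable set, translated to start at 0: {0, 2, ..., 2k} or {0, 1, ..., suc k}.
data Shape : Set where
  even full : ℕ → Shape

-- The Minkowski sum with the step, translated back to start at 0. A `full` shape has at least two
-- points, so adding offsets 0 and 2 to it leaves no gap.
extend : MStep → Shape → Shape
extend sM1    S        = S
extend s0     S        = S
extend sP1    S        = S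
extend sM1P1  (even k) = even (suc k)
extend sM1P1  (full k) = full (suc (suc k))
extend sM10   (even k) = full (k ℕ.+ k)
extend sM10   (full k) = full (suc k)
extend s0P1   (even k) = full (k ℕ.+ k)
extend s0P1   (full k) = full (suc k)
extend sM10P1 (even k) = full (suc (k ℕ.+ k))
extend sM10P1 (full k) = full (suc (suc k))

shape : NWalk → Shape
shape []      = even 0
shape (s ∷ w) = extend s (shape w)

data _∈ˢ_ : ℕ → Shape → Set where
  even : ∀ {k} i → i ℕ.≤ k → (i ℕ.+ i) ∈ˢ even k
  full : ∀ {k j} → j ℕ.≤ suc k → j ∈ˢ full k

width : Shape → ℕ
width (even k) = k ℕ.+ k
width (full k) = suc k

∈ˢ-zero : ∀ S → 0 ∈ˢ S
∈ˢ-zero (even k) = even 0 z≤n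
∈ˢ-zero (full k) = full z≤n

∈ˢ-width : ∀ S → width S ∈ˢ S
∈ˢ-width (even k) = even k ℕₚ.≤-refl
∈ˢ-width (full k) = full ℕₚ.≤-refl

∈ˢ⇒≤width : ∀ {S j} → j ∈ˢ S → j ℕ.≤ width S
∈ˢ⇒≤width (even i i≤k) = ℕₚ.+-mono-≤ i≤k i≤k
∈ˢ⇒≤width (full j≤)    = j≤

offsets : MStep → List ℕ
offsets sM1    = 0 ∷ []
offsets s0     = 0 ∷ []
offsets sP1    = 0 ∷ []
offsets sM10   = 0 ∷ 1 ∷ []
offsets sM1P1  = 0 ∷ 2 ∷ []
offsets s0P1   = 0 ∷ 1 ∷ []
offsets sM10P1 = 0 ∷ 1 ∷ 2 ∷ []

elems-offsets : ∀ s → elems s ≡ map (λ d → low s ℤ.+ + d) (offsets s)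
elems-offsets sM1    = refl
elems-offsets s0     = refl
elems-offsets sP1    = refl
elems-offsets sM10   = refl
elems-offsets sM1P1  = refl
elems-offsets s0P1   = refl
elems-offsets sM10P1 = refl

double-suc : ∀ i → suc i ℕ.+ suc i ≡ suc (suc (i ℕ.+ i))
double-suc i = cong suc (ℕₚ.+-suc i i)

full-+ : ∀ {S d D k} j → d ℕ.≤ D → j ∈ˢ S → D ℕ.+ width S ≡ suc k → (d ℕ.+ j) ∈ˢ full k
full-+ j d≤D j∈S e = full (ℕₚ.≤-trans (ℕₚ.+-mono-≤ d≤D (∈ˢ⇒≤width j∈S)) (ℕₚ.≤-reflexive e))

≤1-offset : ∀ {d} → d ∈ (0 ∷ 1 ∷ []) → d ℕ.≤ 1
≤1-offset (here refl)         = z≤n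
≤1-offset (there (here refl)) = ℕₚ.≤-refl

≤2-offset : ∀ {d} → d ∈ (0 ∷ 1 ∷ 2 ∷ []) → d ℕ.≤ 2
≤2-offset (here refl)                 = z≤n
≤2-offset (there (here refl))         = s≤s z≤n
≤2-offset (there (there (here refl))) = ℕₚ.≤-refl

extend-∈⁺ : ∀ s {S d j} → d ∈ offsets s → j ∈ˢ S → (d ℕ.+ j) ∈ˢ extend s S
extend-∈⁺ sM1   (here refl) j∈ = j∈
extend-∈⁺ s0    (here refl) j∈ = j∈
extend-∈⁺ sP1   (here refl) j∈ = j∈
extend-∈⁺ sM1P1 (here refl) (even i i≤k) = even i (ℕₚ.m≤n⇒m≤1+n i≤k)
extend-∈⁺ sM1P1 {even k} (there (here refl)) (even i i≤k) =
  subst (_∈ˢ even (suc k)) (double-suc i) (even (suc i) (s≤s i≤k))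
extend-∈⁺ sM1P1 (here refl) (full j≤) = full (ℕₚ.m≤n⇒m≤1+n (ℕₚ.m≤n⇒m≤1+n j≤))
extend-∈⁺ sM1P1 (there (here refl)) (full j≤) = full (s≤s (s≤s j≤))
extend-∈⁺ sM10   {even k} d∈ j∈ = full-+ _ (≤1-offset d∈) j∈ refl
extend-∈⁺ sM10   {full k} d∈ j∈ = full-+ _ (≤1-offset d∈) j∈ refl
extend-∈⁺ s0P1   {even k} d∈ j∈ = full-+ _ (≤1-offset d∈) j∈ refl
extend-∈⁺ s0P1   {full k} d∈ j∈ = full-+ _ (≤1-offset d∈) j∈ refl
extend-∈⁺ sM10P1 {even k} d∈ j∈ = full-+ _ (≤2-offset d∈) j∈ refl
extend-∈⁺ sM10P1 {full k} d∈ j∈ = full-+ _ (≤2-offset d∈) j∈ refl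

-- Keeping the bound `i ≤ k` shows that the numbers up to `2k + 1` are exhausted by an even shape
-- together with its translate by 1.
parity-split : ∀ k j → j ℕ.≤ suc (k ℕ.+ k) → ∃[ i ] i ℕ.≤ k × (j ≡ i ℕ.+ i ⊎ j ≡ suc (i ℕ.+ i))
parity-split k zero          _ = 0 , z≤n , inj₁ refl
parity-split k (suc zero)    _ = 0 , z≤n , inj₂ refl
parity-split zero    (suc (suc j)) (s≤s ())
parity-split (suc k) (suc (suc j)) (s≤s (s≤s p))
  with i , i≤k , c ← parity-split k j (ℕₚ.≤-trans p (ℕₚ.≤-reflexive (ℕₚ.+-suc k k))) =
  suc i , s≤s i≤k , lift c
  where
  lift : j ≡ i ℕ.+ i ⊎ j ≡ suc (i ℕ.+ i) →
    suc (suc j) ≡ suc i ℕ.+ suc i ⊎ suc (suc j) ≡ suc (suc i ℕ.+ suc i)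
  lift (inj₁ refl) = inj₁ (sym (double-suc i))
  lift (inj₂ refl) = inj₂ (sym (cong suc (double-suc i)))

Preimage : List ℕ → Shape → ℕ → Set
Preimage D S j = ∃[ d ] ∃[ i ] d ∈ D × i ∈ˢ S × j ≡ d ℕ.+ i

preimage-even : ∀ {D k j} → 0 ∈ D → 1 ∈ D → j ℕ.≤ suc (k ℕ.+ k) → Preimage D (even k) j
preimage-even {k = k} {j} 0∈ 1∈ p with parity-split k j p
... | i , i≤k , inj₁ e = 0 , i ℕ.+ i , 0∈ , even i i≤k , e
... | i , i≤k , inj₂ e = 1 , i ℕ.+ i , 1∈ , even i i≤k , e

preimage-full₁ : ∀ {D k j} → 0 ∈ D → 1 ∈ D → j ℕ.≤ suc (suc k) → Preimage D (full k) j
preimage-full₁ {j = zero}  0∈ 1∈ p       = 0 , 0 , 0∈ , full z≤n , refl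
preimage-full₁ {j = suc j} 0∈ 1∈ (s≤s p) = 1 , j , 1∈ , full p , refl

preimage-full₂ : ∀ {D k j} → 0 ∈ D → 2 ∈ D → j ℕ.≤ suc (suc (suc k)) → Preimage D (full k) j
preimage-full₂ {j = zero}        0∈ 2∈ p             = 0 , 0 , 0∈ , full z≤n , refl
-- The offset 1 is absent from `sM1P1`, but a full shape itself contains 1.
preimage-full₂ {j = suc zero}    0∈ 2∈ p             = 0 , 1 , 0∈ , full (s≤s z≤n) , refl
preimage-full₂ {j = suc (suc j)} 0∈ 2∈ (s≤s (s≤s p)) = 2 , j , 2∈ , full p , refl

pattern first  = here refl
pattern second = there (here refl)
pattern third  = there (there (here refl))

extend-∈⁻ : ∀ s {S j} → j ∈ˢ extend s S → Preimage (offsets s) S j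
extend-∈⁻ sM1   j∈ = 0 , _ , first , j∈ , refl
extend-∈⁻ s0    j∈ = 0 , _ , first , j∈ , refl
extend-∈⁻ sP1   j∈ = 0 , _ , first , j∈ , refl
extend-∈⁻ sM1P1 {even k} (even zero p)          = 0 , 0 , first , even 0 z≤n , refl
extend-∈⁻ sM1P1 {even k} (even (suc i) (s≤s p)) = 2 , i ℕ.+ i , second , even i p , double-suc i
extend-∈⁻ sM1P1 {full k} (full p) = preimage-full₂ first second p
extend-∈⁻ sM10  {even k} (full p) = preimage-even first second p
extend-∈⁻ sM10  {full k} (full p) = preimage-full₁ first second p
extend-∈⁻ s0P1  {even k} (full p) = preimage-even first second p
extend-∈⁻ s0P1  {full k} (full p) = preimage-full₁ first second p
extend-∈⁻ sM10P1 {full k} (full p) = preimage-full₂ first third p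
extend-∈⁻ sM10P1 {even k} {j} (full p) with ℕₚ.m≤n⇒m<n∨m≡n p
-- Offsets 0 and 1 reach up to `2k + 1`; only the top value `2k + 2` takes the offset 2.
... | inj₁ (s≤s q) = preimage-even first second q
... | inj₂ refl    = 2 , k ℕ.+ k , third , even k ℕₚ.≤-refl , refl

reachable-∷⁻ : ∀ s w {v} → v ∈ reachable (s ∷ w) →
  ∃[ u ] ∃[ v′ ] u ∈ elems s × v′ ∈ reachable w × v ≡ u ℤ.+ v′
reachable-∷⁻ s w v∈
  with c , c∈ , refl ← ∈-map⁻ sumℤ v∈
  with u , u∈ , c∈′ ← find (∈-concatMap⁻ (λ u → map (u ∷_) (compatible w)) {elems s} c∈)
  with c′ , c′∈ , refl ← ∈-map⁻ (u ∷_) c∈′ =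
  u , sumℤ c′ , u∈ , ∈-map⁺ sumℤ c′∈ , refl

reachable-∷⁺ : ∀ s w {u v} → u ∈ elems s → v ∈ reachable w → (u ℤ.+ v) ∈ reachable (s ∷ w)
reachable-∷⁺ s w {u} u∈ v∈ with c , c∈ , refl ← ∈-map⁻ sumℤ v∈ =
  ∈-map⁺ sumℤ (∈-concatMap⁺ (λ u → map (u ∷_) (compatible w)) (lose u∈ (∈-map⁺ (u ∷_) c∈)))

regroup : ∀ l d m j → (l ℤ.+ + d) ℤ.+ (m ℤ.+ + j) ≡ (l ℤ.+ m) ℤ.+ + (d ℕ.+ j)
regroup l d m j = solve 4 (λ l d m j → (l :+ d) :+ (m :+ j) := (l :+ m) :+ (d :+ j)) refl l (+ d) m (+ j)

-- With the converse below, the reachable set is the shape translated by `lower w`. Prepending a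
-- step adds the translations and the offsets separately, which is `regroup`.
reachable⇒shape : ∀ w {v} → v ∈ reachable w → ∃[ j ] j ∈ˢ shape w × v ≡ lower w ℤ.+ + j
reachable⇒shape []      (here refl) = 0 , even 0 z≤n , refl
reachable⇒shape (s ∷ w) v∈
  with u , v′ , u∈ , v′∈ , refl ← reachable-∷⁻ s w v∈
  with j , j∈ , refl ← reachable⇒shape w v′∈
  with d , d∈ , refl ← ∈-map⁻ (λ d → low s ℤ.+ + d) (subst (u ∈_) (elems-offsets s) u∈) =
  d ℕ.+ j , extend-∈⁺ s d∈ j∈ , regroup (low s) d (lower w) j

shape⇒reachable : ∀ w {j} → j ∈ˢ shape w → (lower w ℤ.+ + j) ∈ reachable w
shape⇒reachable []      (even zero z≤n) = here refl
shape⇒reachable (s ∷ w) j∈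
  with d , i , d∈ , i∈ , refl ← extend-∈⁻ s {shape w} j∈ =
  subst (_∈ reachable (s ∷ w)) (regroup (low s) d (lower w) i)
    (reachable-∷⁺ s w
      (subst (low s ℤ.+ + d ∈_) (sym (elems-offsets s)) (∈-map⁺ (λ d → low s ℤ.+ + d) d∈))
      (shape⇒reachable w i∈))

minimum-≤ : ∀ x xs {y} → y ∈ (x ∷ xs) → foldr ℤ._⊓_ x xs ℤ.≤ y
minimum-≤ x []       (here refl)         = ℤₚ.≤-refl
minimum-≤ x (z ∷ xs) (here refl)         = ℤₚ.≤-trans (ℤₚ.i⊓j≤j z _) (minimum-≤ x xs (here refl))
minimum-≤ x (z ∷ xs) (there (here refl)) = ℤₚ.i⊓j≤i z _
minimum-≤ x (z ∷ xs) (there (there y∈))  = ℤₚ.≤-trans (ℤₚ.i⊓j≤j z _) (minimum-≤ x xs (there y∈))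

maximum-≥ : ∀ x xs {y} → y ∈ (x ∷ xs) → y ℤ.≤ foldr ℤ._⊔_ x xs
maximum-≥ x []       (here refl)         = ℤₚ.≤-refl
maximum-≥ x (z ∷ xs) (here refl)         = ℤₚ.≤-trans (maximum-≥ x xs (here refl)) (ℤₚ.i≤j⊔i z _)
maximum-≥ x (z ∷ xs) (there (here refl)) = ℤₚ.i≤i⊔j z _
maximum-≥ x (z ∷ xs) (there (there y∈))  = ℤₚ.≤-trans (maximum-≥ x xs (there y∈)) (ℤₚ.i≤j⊔i z _)

foldr-∈ : ∀ (_∙_ : ℤ → ℤ → ℤ) → (∀ i j → i ∙ j ≡ i ⊎ i ∙ j ≡ j) →
  ∀ x xs → foldr _∙_ x xs ∈ (x ∷ xs)
foldr-∈ _∙_ sel x []       = here refl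
foldr-∈ _∙_ sel x (z ∷ xs) with sel z (foldr _∙_ x xs)
... | inj₁ e = there (here e)
... | inj₂ e with foldr-∈ _∙_ sel x xs
...   | here p  = here (trans e p)
...   | there p = there (there (subst (_∈ xs) (sym e) p))

minimumℤ-unique : ∀ {xs y} → y ∈ xs → (∀ {z} → z ∈ xs → y ℤ.≤ z) → minimumℤ xs ≡ y
minimumℤ-unique {x ∷ xs} y∈ y≤ =
  ℤₚ.≤-antisym (minimum-≤ x xs y∈) (y≤ (foldr-∈ ℤ._⊓_ ℤₚ.⊓-sel x xs))

maximumℤ-unique : ∀ {xs y} → y ∈ xs → (∀ {z} → z ∈ xs → z ℤ.≤ y) → maximumℤ xs ≡ y
maximumℤ-unique {x ∷ xs} y∈ ≤y =
  ℤₚ.≤-antisym (≤y (foldr-∈ ℤ._⊔_ ℤₚ.⊔-sel x xs)) (maximum-≥ x xs y∈)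

minW≡lower : ∀ w → minW w ≡ lower w
minW≡lower w = minimumℤ-unique
  (subst (_∈ reachable w) (ℤₚ.+-identityʳ (lower w)) (shape⇒reachable w (∈ˢ-zero (shape w))))
  (λ z∈ → let j , _ , e = reachable⇒shape w z∈ in
    subst (lower w ℤ.≤_) (sym e) (ℤₚ.i≤i+j (lower w) (+ j)))

maxW≡lower+width : ∀ w → maxW w ≡ lower w ℤ.+ + width (shape w)
maxW≡lower+width w = maximumℤ-unique (shape⇒reachable w (∈ˢ-width (shape w)))
  (λ z∈ → let j , j∈ , e = reachable⇒shape w z∈ in
    subst (ℤ._≤ lower w ℤ.+ + width (shape w)) (sym e)
      (ℤₚ.+-monoʳ-≤ (lower w) (ℤ.+≤+ (∈ˢ⇒≤width j∈))))

spread : MStep → ℕ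
spread sM1    = 0
spread s0     = 0
spread sP1    = 0
spread sM10   = 1
spread sM1P1  = 2
spread s0P1   = 1
spread sM10P1 = 2

width-extend : ∀ s S → width (extend s S) ≡ spread s ℕ.+ width S
width-extend sM1    S        = refl
width-extend s0     S        = refl
width-extend sP1    S        = refl
width-extend sM10   (even k) = refl
width-extend sM10   (full k) = refl
width-extend sM1P1  (even k) = double-suc k
width-extend sM1P1  (full k) = refl
width-extend s0P1   (even k) = refl
width-extend s0P1   (full k) = refl
width-extend sM10P1 (even k) = refl
width-extend sM10P1 (full k) = refl

neghigh≡ : ∀ s → ℤ.- neghigh s ≡ low s ℤ.+ + spread s
neghigh≡ sM1    = refl
neghigh≡ s0     = refl
neghigh≡ sP1    = refl
neghigh≡ sM10   = refl
neghigh≡ sM1P1  = refl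
neghigh≡ s0P1   = refl
neghigh≡ sM10P1 = refl

lower+width : ∀ w → ℤ.- neghigher w ≡ lower w ℤ.+ + width (shape w)
lower+width []      = refl
lower+width (s ∷ w) = trans (ℤₚ.neg-distrib-+ (neghigh s) (neghigher w))
  (trans (cong₂ ℤ._+_ (neghigh≡ s) (lower+width w))
    (trans (regroup (low s) (spread s) (lower w) (width (shape w)))
      (cong (λ j → low s ℤ.+ lower w ℤ.+ + j) (sym (width-extend s (shape w))))))

maxW≡ : ∀ w → maxW w ≡ ℤ.- neghigher w
maxW≡ w = trans (maxW≡lower+width w) (sym (lower+width w))

-- From walks to weighted counts

sumOver : {A : Set} → (A → ℤ) → List A → ℤ
sumOver f []       = + 0
sumOver f (x ∷ xs) = f x ℤ.+ sumOver f xs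

bit : Bool → ℤ
bit true  = + 1
bit false = + 0

module _ {A : Set} where

  sumOver-cong : ∀ {f g : A → ℤ} xs → (∀ x → f x ≡ g x) → sumOver f xs ≡ sumOver g xs
  sumOver-cong []       e = refl
  sumOver-cong (x ∷ xs) e = cong₂ ℤ._+_ (e x) (sumOver-cong xs e)

  sumOver-++ : ∀ (f : A → ℤ) xs ys → sumOver f (xs ++ ys) ≡ sumOver f xs ℤ.+ sumOver f ys
  sumOver-++ f []       ys = sym (ℤₚ.+-identityˡ _)
  sumOver-++ f (x ∷ xs) ys =
    trans (cong (ℤ._+_ (f x)) (sumOver-++ f xs ys)) (sym (ℤₚ.+-assoc (f x) _ _))

  sumOver-+ : ∀ (f g : A → ℤ) xs → sumOver (λ x → f x ℤ.+ g x) xs ≡ sumOver f xs ℤ.+ sumOver g xs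
  sumOver-+ f g []       = refl
  sumOver-+ f g (x ∷ xs) = trans (cong (ℤ._+_ (f x ℤ.+ g x)) (sumOver-+ f g xs))
    (solve 4 (λ a b c d → (a :+ b) :+ (c :+ d) := (a :+ c) :+ (b :+ d)) refl (f x) (g x) _ _)

  sumOver-* : ∀ v (f : A → ℤ) xs → sumOver (λ x → v ℤ.* f x) xs ≡ v ℤ.* sumOver f xs
  sumOver-* v f []       = sym (ℤₚ.*-zeroʳ v)
  sumOver-* v f (x ∷ xs) =
    trans (cong (ℤ._+_ (v ℤ.* f x)) (sumOver-* v f xs)) (sym (ℤₚ.*-distribˡ-+ v (f x) _))

  sumOver-map : ∀ {B : Set} (f : A → ℤ) (h : B → A) xs → sumOver f (map h xs) ≡ sumOver (f ∘ h) xs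
  sumOver-map f h []       = refl
  sumOver-map f h (x ∷ xs) = cong (ℤ._+_ (f (h x))) (sumOver-map f h xs)

  length-filter : ∀ {P : Pred A 0ℓ} (P? : Decidable P) xs →
    + length (filter P? xs) ≡ sumOver (λ x → bit (does (P? x))) xs
  length-filter P? []       = refl
  length-filter P? (x ∷ xs) with does (P? x)
  ... | true  = cong ℤ.suc (length-filter P? xs)
  ... | false = trans (length-filter P? xs) (sym (ℤₚ.+-identityˡ _))

sumOver-concatMap : ∀ {A B : Set} (f : B → ℤ) (h : A → List B) xs →
  sumOver f (concatMap h xs) ≡ sumOver (λ x → sumOver f (h x)) xs
sumOver-concatMap f h []       = refl
sumOver-concatMap f h (x ∷ xs) =
  trans (sumOver-++ f (h x) (concatMap h xs)) (cong (ℤ._+_ (sumOver f (h x))) (sumOver-concatMap f h xs))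

-- Testing sums against 0 means that prepending a step merely shifts both arguments, as in the
-- recursion of `count`.
at : ℤ → ℤ → NWalk → ℤ
at a b w = indicator (lower w ℤ.+ a) ℤ.* indicator (neghigher w ℤ.+ b)

-- `sM1P1` and `sM10P1` have the same extremes, so `count` sees only `k₁ + k₂`. The weights are
-- separate because, of the two, only `sM1P1` preserves even shapes.
module Weighted (e m k₁ k₂ : ℤ) where
  open Counting e m (k₁ ℤ.+ k₂)

  weight : MStep → ℤ
  weight sM1    = e
  weight s0     = + 1
  weight sP1    = e
  weight sM10   = m
  weight sM1P1  = k₁
  weight s0P1   = m
  weight sM10P1 = k₂

  walkWeight : NWalk → ℤ
  walkWeight []      = + 1
  walkWeight (s ∷ w) = weight s ℤ.* walkWeight w

  weightedAt : ℤ → ℤ → NWalk → ℤ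
  weightedAt a b w = walkWeight w ℤ.* at a b w

  weightedAt-∷ : ∀ s w a b →
    weightedAt a b (s ∷ w) ≡ weight s ℤ.* weightedAt (low s ℤ.+ a) (neghigh s ℤ.+ b) w
  weightedAt-∷ s w a b = trans
    (cong₂ (λ i j → weight s ℤ.* walkWeight w ℤ.* (indicator i ℤ.* indicator j))
      (swap (low s) (lower w) a) (swap (neghigh s) (neghigher w) b))
    (ℤₚ.*-assoc (weight s) (walkWeight w) _)
    where
    swap : ∀ u v a → u ℤ.+ v ℤ.+ a ≡ v ℤ.+ (u ℤ.+ a)
    swap = solve 3 (λ u v a → u :+ v :+ a := v :+ (u :+ a)) refl

  sumOver-weightedAt : ∀ n a b → sumOver (weightedAt a b) (allWalks n) ≡ count n a b
  sumOver-weightedAt zero    a b = trans (ℤₚ.+-identityʳ _) (trans (ℤₚ.*-identityˡ _)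
    (cong₂ (λ i j → indicator i ℤ.* indicator j) (ℤₚ.+-identityˡ a) (ℤₚ.+-identityˡ b)))
  sumOver-weightedAt (suc n) a b = begin
    sumOver (weightedAt a b) (concatMap (λ s → map (s ∷_) (allWalks n)) allSteps)
      ≡⟨ sumOver-concatMap (weightedAt a b) (λ s → map (s ∷_) (allWalks n)) allSteps ⟩
    sumOver (λ s → sumOver (weightedAt a b) (map (s ∷_) (allWalks n))) allSteps
      ≡⟨ sumOver-cong allSteps byStep ⟩
    sumOver (λ s → weight s ℤ.* count n (low s ℤ.+ a) (neghigh s ℤ.+ b)) allSteps
      ≡⟨ cong₂ (λ i j → e ℤ.* count n (ℤ.pred a) (ℤ.suc b) ℤ.+ (+ 1 ℤ.* count n i j ℤ.+
           (e ℤ.* count n (ℤ.suc a) (ℤ.pred b) ℤ.+ (m ℤ.* count n (ℤ.pred a) j ℤ.+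
           (k₁ ℤ.* count n (ℤ.pred a) (ℤ.pred b) ℤ.+ (m ℤ.* count n i (ℤ.pred b) ℤ.+
           (k₂ ℤ.* count n (ℤ.pred a) (ℤ.pred b) ℤ.+ + 0))))))) (ℤₚ.+-identityˡ a) (ℤₚ.+-identityˡ b) ⟩
    _ ≡⟨ solve 10 (λ e m k₁ k₂ p q r s t u →
           e :* p :+ (con (+ 1) :* q :+ (e :* r :+ (m :* s :+ (k₁ :* u :+ (m :* t :+ (k₂ :* u :+ con (+ 0))))))) :=
           e :* p :+ q :+ e :* r :+ m :* s :+ m :* t :+ (k₁ :+ k₂) :* u) refl e m k₁ k₂ _ _ _ _ _ _ ⟩
    count (suc n) a b ∎
    where
    open ≡.≡-Reasoning
    byStep : ∀ s → sumOver (weightedAt a b) (map (s ∷_) (allWalks n)) ≡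
      weight s ℤ.* count n (low s ℤ.+ a) (neghigh s ℤ.+ b)
    byStep s = begin
      sumOver (weightedAt a b) (map (s ∷_) (allWalks n))
        ≡⟨ sumOver-map (weightedAt a b) (s ∷_) (allWalks n) ⟩
      sumOver (λ w → weightedAt a b (s ∷ w)) (allWalks n)
        ≡⟨ sumOver-cong (allWalks n) (λ w → weightedAt-∷ s w a b) ⟩
      sumOver (λ w → weight s ℤ.* weightedAt (low s ℤ.+ a) (neghigh s ℤ.+ b) w) (allWalks n)
        ≡⟨ sumOver-* (weight s) (weightedAt _ _) (allWalks n) ⟩
      weight s ℤ.* sumOver (weightedAt (low s ℤ.+ a) (neghigh s ℤ.+ b)) (allWalks n)
        ≡⟨ cong (ℤ._*_ (weight s)) (sumOver-weightedAt n _ _) ⟩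
      weight s ℤ.* count n (low s ℤ.+ a) (neghigh s ℤ.+ b) ∎

-- Weights that detect even shapes and the parity of the minimum

module All  = Weighted (+ 1) (+ 1) (+ 1) (+ 1)
module Even = Weighted (+ 1) (+ 0) (+ 1) (+ 0)
module Sign = Weighted -[1+ 0 ] (+ 0) -[1+ 0 ] (+ 0)

isEven : Shape → ℤ
isEven (even _) = + 1
isEven (full _) = + 0

alternating : ℕ → ℤ
alternating zero    = + 1
alternating (suc n) = ℤ.- alternating n

sign : ℤ → ℤ
sign i = alternating ℤ.∣ i ∣

sign-suc : ∀ i → sign (ℤ.suc i) ≡ ℤ.- sign i
sign-suc (+ n)          = refl
sign-suc -[1+ zero ]    = refl
sign-suc -[1+ suc n ]   = sym (ℤₚ.neg-involutive _)

sign-pred : ∀ i → sign (ℤ.pred i) ≡ ℤ.- sign i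
sign-pred (+ zero)  = refl
sign-pred (+ suc n) = sym (ℤₚ.neg-involutive _)
sign-pred -[1+ n ]  = refl

allWeight : ∀ w → All.walkWeight w ≡ + 1
allWeight []           = refl
allWeight (sM1    ∷ w) = trans (ℤₚ.*-identityˡ _) (allWeight w)
allWeight (s0     ∷ w) = trans (ℤₚ.*-identityˡ _) (allWeight w)
allWeight (sP1    ∷ w) = trans (ℤₚ.*-identityˡ _) (allWeight w)
allWeight (sM10   ∷ w) = trans (ℤₚ.*-identityˡ _) (allWeight w)
allWeight (sM1P1  ∷ w) = trans (ℤₚ.*-identityˡ _) (allWeight w)
allWeight (s0P1   ∷ w) = trans (ℤₚ.*-identityˡ _) (allWeight w)
allWeight (sM10P1 ∷ w) = trans (ℤₚ.*-identityˡ _) (allWeight w)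

-- An even shape stays even exactly under the steps of weight 1 in `Even`, and a full shape stays
-- full; so the product of the weights is the indicator of even shape.
isEven-extend : ∀ s S → Even.weight s ℤ.* isEven S ≡ isEven (extend s S)
isEven-extend sM1    S        = ℤₚ.*-identityˡ _
isEven-extend s0     S        = ℤₚ.*-identityˡ _
isEven-extend sP1    S        = ℤₚ.*-identityˡ _
isEven-extend sM10   (even k) = refl
isEven-extend sM10   (full k) = refl
isEven-extend sM1P1  (even k) = refl
isEven-extend sM1P1  (full k) = refl
isEven-extend s0P1   (even k) = refl
isEven-extend s0P1   (full k) = refl
isEven-extend sM10P1 (even k) = refl
isEven-extend sM10P1 (full k) = refl

evenWeight : ∀ w → Even.walkWeight w ≡ isEven (shape w)
evenWeight []      = refl
evenWeight (s ∷ w) = trans (cong (Even.weight s ℤ.*_) (evenWeight w)) (isEven-extend s (shape w))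

-- Among the steps that preserve even shapes, those of weight `-1` in `Sign` are the ones with odd
-- minimum, so the signs multiply to the parity of `lower w`. For the other steps both sides are 0.
signStep : ∀ s i → Sign.weight s ℤ.* sign i ≡ Even.weight s ℤ.* sign (low s ℤ.+ i)
signStep sM1    i = trans (ℤₚ.-1*i≡-i (sign i)) (sym (trans (ℤₚ.*-identityˡ _) (sign-pred i)))
signStep s0     i = cong (λ j → + 1 ℤ.* sign j) (sym (ℤₚ.+-identityˡ i))
signStep sP1    i = trans (ℤₚ.-1*i≡-i (sign i)) (sym (trans (ℤₚ.*-identityˡ _) (sign-suc i)))
signStep sM10   i = refl
signStep sM1P1  i = trans (ℤₚ.-1*i≡-i (sign i)) (sym (trans (ℤₚ.*-identityˡ _) (sign-pred i)))
signStep s0P1   i = refl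
signStep sM10P1 i = refl

signWeight : ∀ w → Sign.walkWeight w ≡ Even.walkWeight w ℤ.* sign (lower w)
signWeight []      = refl
signWeight (s ∷ w) = begin
  Sign.weight s ℤ.* Sign.walkWeight w
    ≡⟨ cong (Sign.weight s ℤ.*_) (signWeight w) ⟩
  Sign.weight s ℤ.* (Even.walkWeight w ℤ.* sign (lower w))
    ≡⟨ solve 3 (λ a b c → a :* (b :* c) := b :* (a :* c)) refl (Sign.weight s) (Even.walkWeight w) _ ⟩
  Even.walkWeight w ℤ.* (Sign.weight s ℤ.* sign (lower w))
    ≡⟨ cong (Even.walkWeight w ℤ.*_) (signStep s (lower w)) ⟩
  Even.walkWeight w ℤ.* (Even.weight s ℤ.* sign (low s ℤ.+ lower w))
    ≡⟨ solve 3 (λ a b c → b :* (a :* c) := a :* b :* c) refl (Even.weight s) (Even.walkWeight w) _ ⟩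
  Even.weight s ℤ.* Even.walkWeight w ℤ.* sign (low s ℤ.+ lower w) ∎
  where open ≡.≡-Reasoning

indicator-≢ : ∀ {i} → i ≢ + 0 → indicator i ≡ + 0
indicator-≢ {+ zero}    i≢0 = contradiction refl i≢0
indicator-≢ {+ suc n}   i≢0 = refl
indicator-≢ { -[1+ n ]} i≢0 = refl

alternating-double : ∀ i → alternating (i ℕ.+ i) ≡ + 1
alternating-double zero    = refl
alternating-double (suc i) = trans (cong alternating (double-suc i))
  (trans (ℤₚ.neg-involutive _) (alternating-double i))

even⊎odd : ∀ a → ∃[ i ] (a ≡ i ℕ.+ i ⊎ a ≡ suc (i ℕ.+ i))
even⊎odd a with i , _ , c ← parity-split a a (ℕₚ.m≤n⇒m≤1+n (ℕₚ.m≤m+n a a)) = i , c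

Bridge? : ∀ a b w → Dec (IsBridge w × minW w ≡ ℤ.- + a × maxW w ≡ + b)
Bridge? a b w = (+ 0 ∈? reachable w) ×-dec (minW w ℤ.≟ ℤ.- (+ a)) ×-dec (maxW w ℤ.≟ + b)

≤-from-double : ∀ {i k} → i ℕ.+ i ℕ.≤ k ℕ.+ k → i ℕ.≤ k
≤-from-double {i} {k} p with i ℕₚ.≤? k
... | yes i≤k = i≤k
... | no  i≰k = contradiction p (ℕₚ.<⇒≱ (ℕₚ.+-mono-< (ℕₚ.≰⇒> i≰k) (ℕₚ.≰⇒> i≰k)))

double≢odd : ∀ i j → j ℕ.+ j ≢ suc (i ℕ.+ i)
double≢odd i j p with trans (sym (alternating-double j))
  (trans (cong alternating p) (cong ℤ.-_ (alternating-double i)))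
... | ()

even-∈⁻ : ∀ {j k} → j ∈ˢ even k → ∃[ i ] j ≡ i ℕ.+ i
even-∈⁻ (even i _) = i , refl

at-1 : ∀ {a b} w → lower w ≡ ℤ.- + a → neghigher w ≡ ℤ.- + b → at (+ a) (+ b) w ≡ + 1
at-1 {a} {b} w p q rewrite p | q | ℤₚ.+-inverseˡ (+ a) | ℤₚ.+-inverseˡ (+ b) = refl

i+j≡0⇒i≡-j : ∀ i j → i ℤ.+ j ≡ + 0 → i ≡ ℤ.- j
i+j≡0⇒i≡-j i j p = trans (solve 2 (λ i j → i := (i :+ j) :+ :- j) refl i j)
  (trans (cong (λ u → u ℤ.+ ℤ.- j) p) (ℤₚ.+-identityˡ _))

module _ (a b : ℕ) (w : NWalk) (lower≡ : lower w ≡ ℤ.- + a) (neghigher≡ : neghigher w ≡ ℤ.- + b) where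

  width≡ : width (shape w) ≡ a ℕ.+ b
  width≡ = ℤₚ.+-injective (begin
    + width (shape w)
      ≡⟨ solve 2 (λ l v → v := (l :+ v) :- l) refl (lower w) (+ width (shape w)) ⟩
    (lower w ℤ.+ + width (shape w)) ℤ.- lower w
      ≡⟨ cong₂ ℤ._-_ (sym (lower+width w)) lower≡ ⟩
    ℤ.- neghigher w ℤ.- ℤ.- + a
      ≡⟨ cong (λ h → ℤ.- h ℤ.- ℤ.- + a) neghigher≡ ⟩
    ℤ.- ℤ.- + b ℤ.- ℤ.- + a
      ≡⟨ solve 2 (λ a b → :- (:- b) :- :- a := a :+ b) refl (+ a) (+ b) ⟩
    + a ℤ.+ + b ∎)
    where open ≡.≡-Reasoning

  -- Since `lower w` is `-a`, the point 0 is the translate of the offset `a`.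
  does-bridge : a ∈ˢ shape w → does (Bridge? a b w) ≡ true
  does-bridge a∈ = dec-true (Bridge? a b w)
    ( subst (_∈ reachable w) (trans (cong (ℤ._+ + a) lower≡) (ℤₚ.+-inverseˡ (+ a))) (shape⇒reachable w a∈)
    , trans (minW≡lower w) lower≡
    , trans (maxW≡ w) (trans (cong ℤ.-_ neghigher≡) (ℤₚ.neg-involutive (+ b))))

  does-not-bridge : ¬ a ∈ˢ shape w → does (Bridge? a b w) ≡ false
  does-not-bridge a∉ = dec-false (Bridge? a b w) λ (0∈ , _) →
    let j , j∈ , p = reachable⇒shape w 0∈
        a≡j = ℤₚ.neg-injective (trans (sym lower≡)
                (i+j≡0⇒i≡-j (lower w) (+ j) (sym p)))
    in a∉ (subst (_∈ˢ shape w) (sym (ℤₚ.+-injective a≡j)) j∈)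

  sign-lower : sign (lower w) ≡ alternating a
  sign-lower = trans (cong sign lower≡) (cong alternating (ℤₚ.∣-i∣≡∣i∣ (+ a)))

  -- A full shape contains `a` because `a ≤ a + b`, its width; an even one contains `a` exactly if
  -- `a` is even. Doubling clears the denominator of `(1 - (-1)^a) / 2`, the indicator of odd `a`.
  bridge-indicator : + 2 ℤ.* bit (does (Bridge? a b w)) ≡
    + 2 ℤ.- isEven (shape w) ℤ.+ isEven (shape w) ℤ.* alternating a
  bridge-indicator with shape w | width≡ | does-bridge | does-not-bridge
  ... | full k | width≡ | bridge | _
    rewrite bridge (full (ℕₚ.≤-trans (ℕₚ.m≤m+n a b) (ℕₚ.≤-reflexive (sym width≡)))) = refl
  ... | even k | width≡ | bridge | not-bridge with even⊎odd a
  ...   | i , inj₁ refl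
    rewrite bridge (even i (≤-from-double (ℕₚ.≤-trans (ℕₚ.m≤m+n a b) (ℕₚ.≤-reflexive (sym width≡)))))
          | alternating-double i = refl
  ...   | i , inj₂ refl
    rewrite not-bridge (λ a∈ → let j , p = even-∈⁻ a∈ in double≢odd i j (sym p))
          | alternating-double i = refl

bridge-weights : ∀ a b w → + 2 ℤ.* bit (does (Bridge? a b w)) ≡
  + 2 ℤ.* All.weightedAt (+ a) (+ b) w
    ℤ.+ (-[1+ 0 ] ℤ.* Even.weightedAt (+ a) (+ b) w ℤ.+ Sign.weightedAt (+ a) (+ b) w)
bridge-weights a b w = trans (cases (lower w ℤ.≟ ℤ.- + a) (neghigher w ℤ.≟ ℤ.- + b)) (sym expand)
  where
  E I σ : ℤ
  E = isEven (shape w)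
  I = at (+ a) (+ b) w
  σ = sign (lower w)

  expand : + 2 ℤ.* All.weightedAt (+ a) (+ b) w
    ℤ.+ (-[1+ 0 ] ℤ.* Even.weightedAt (+ a) (+ b) w ℤ.+ Sign.weightedAt (+ a) (+ b) w)
    ≡ (+ 2 ℤ.- E ℤ.+ E ℤ.* σ) ℤ.* I
  expand = trans
    (cong₂ ℤ._+_ (cong (λ u → + 2 ℤ.* (u ℤ.* I)) (allWeight w))
      (cong₂ (λ u v → -[1+ 0 ] ℤ.* (u ℤ.* I) ℤ.+ v ℤ.* I) (evenWeight w)
        (trans (signWeight w) (cong (ℤ._* σ) (evenWeight w)))))
    (solve 3 (λ E I σ → con (+ 2) :* (con (+ 1) :* I) :+ (con -[1+ 0 ] :* (E :* I) :+ E :* σ :* I) :=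
      (con (+ 2) :- E :+ E :* σ) :* I) refl E I σ)

  vanish : I ≡ + 0 → ¬ (IsBridge w × minW w ≡ ℤ.- + a × maxW w ≡ + b) →
    + 2 ℤ.* bit (does (Bridge? a b w)) ≡ (+ 2 ℤ.- E ℤ.+ E ℤ.* σ) ℤ.* I
  vanish p ¬bridge rewrite dec-false (Bridge? a b w) ¬bridge =
    sym (trans (cong ((+ 2 ℤ.- E ℤ.+ E ℤ.* σ) ℤ.*_) p) (ℤₚ.*-zeroʳ (+ 2 ℤ.- E ℤ.+ E ℤ.* σ)))

  cases : Dec (lower w ≡ ℤ.- + a) → Dec (neghigher w ≡ ℤ.- + b) →
    + 2 ℤ.* bit (does (Bridge? a b w)) ≡ (+ 2 ℤ.- E ℤ.+ E ℤ.* σ) ℤ.* I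
  cases (yes p) (yes q) = trans (bridge-indicator a b w p q)
    (trans (sym (ℤₚ.*-identityʳ _))
      (cong₂ (λ s i → (+ 2 ℤ.- E ℤ.+ E ℤ.* s) ℤ.* i) (sym (sign-lower a b w p q)) (sym (at-1 w p q))))
  cases (no ¬p) _ = vanish
    (cong (ℤ._* indicator (neghigher w ℤ.+ + b)) (indicator-≢ (¬p ∘ i+j≡0⇒i≡-j (lower w) (+ a))))
    (λ (_ , m , _) → ¬p (trans (sym (minW≡lower w)) m))
  cases (yes _) (no ¬q) = vanish
    (trans (cong (indicator (lower w ℤ.+ + a) ℤ.*_)
             (indicator-≢ (¬q ∘ i+j≡0⇒i≡-j (neghigher w) (+ b))))
           (ℤₚ.*-zeroʳ (indicator (lower w ℤ.+ + a))))
    (λ (_ , _ , m) → ¬q (trans (sym (ℤₚ.neg-involutive _))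
      (cong ℤ.-_ (trans (sym (maxW≡ w)) m))))

-- Assembling the equation of the bridge series

twice-bridgeGF : (K (+ 2) S.* QuadrantSeries.quadrant (+ 1) (+ 1) (+ 2)
    S.+ (K -[1+ 0 ] S.* QuadrantSeries.quadrant (+ 1) (+ 0) (+ 1)
         S.+ QuadrantSeries.quadrant -[1+ 0 ] (+ 0) -[1+ 0 ]))
  S.≈ K (+ 2) S.* bridgeGF
twice-bridgeGF a b n = begin
  _ ≡⟨ cong₂ ℤ._+_ (trans (K-* (+ 2) (QuadrantSeries.quadrant (+ 1) (+ 1) (+ 2)) a b n)
                       (cong (+ 2 ℤ.*_) (sym (All.sumOver-weightedAt n (+ a) (+ b)))))
       (cong₂ ℤ._+_ (trans (K-* -[1+ 0 ] (QuadrantSeries.quadrant (+ 1) (+ 0) (+ 1)) a b n)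
                       (cong (-[1+ 0 ] ℤ.*_) (sym (Even.sumOver-weightedAt n (+ a) (+ b)))))
                    (sym (Sign.sumOver-weightedAt n (+ a) (+ b)))) ⟩
  + 2 ℤ.* sumOver α W ℤ.+ (-[1+ 0 ] ℤ.* sumOver β W ℤ.+ sumOver γ W)
    ≡⟨ cong₂ ℤ._+_ (sym (sumOver-* (+ 2) α W))
         (trans (cong (ℤ._+ sumOver γ W) (sym (sumOver-* -[1+ 0 ] β W))) (sym (sumOver-+ _ γ W))) ⟩
  sumOver (λ w → + 2 ℤ.* α w) W ℤ.+ sumOver (λ w → -[1+ 0 ] ℤ.* β w ℤ.+ γ w) W
    ≡⟨ sym (sumOver-+ _ _ W) ⟩
  sumOver (λ w → + 2 ℤ.* α w ℤ.+ (-[1+ 0 ] ℤ.* β w ℤ.+ γ w)) W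
    ≡⟨ sumOver-cong W (λ w → sym (bridge-weights a b w)) ⟩
  sumOver (λ w → + 2 ℤ.* bit (does (Bridge? a b w))) W
    ≡⟨ sumOver-* (+ 2) _ W ⟩
  + 2 ℤ.* sumOver (λ w → bit (does (Bridge? a b w))) W
    ≡⟨ cong (+ 2 ℤ.*_) (sym (length-filter (Bridge? a b) W)) ⟩
  + 2 ℤ.* bridgeGF a b n
    ≡⟨ sym (K-* (+ 2) bridgeGF a b n) ⟩
  (K (+ 2) S.* bridgeGF) a b n ∎
  where
  open ≡.≡-Reasoning
  W = allWalks n
  α = All.weightedAt (+ a) (+ b)
  β = Even.weightedAt (+ a) (+ b)
  γ = Sign.weightedAt (+ a) (+ b)

-- The factor 2 of `twice-bridgeGF` is removed by completing it with `x y` to `θ`, which keeps the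
-- denominator a power of `θ` modulo `t`.
sumOfRoots-bridgeGF : SumOfRoots bridgeGF
sumOfRoots-bridgeGF =
  SumOfRoots-divide (IsPolynomial-K (+ 2)) (IsPolynomial-* IsPolynomial-x IsPolynomial-y)
    (S.*-congʳ {x S.* y} K2≈1+1)
    (SumOfRoots-resp twice-bridgeGF
      (SumOfRoots-+
        (SumOfRoots-scale (IsPolynomial-K (+ 2)) (sumOfRoots-quadrant (+ 1) (+ 1) (+ 2)))
        (SumOfRoots-+
          (SumOfRoots-scale (IsPolynomial-K -[1+ 0 ]) (sumOfRoots-quadrant (+ 1) (+ 0) (+ 1)))
          (sumOfRoots-quadrant -[1+ 0 ] (+ 0) -[1+ 0 ]))))
  where
  open QuadrantSeries using (sumOfRoots-quadrant)
  K2≈1+1 : K (+ 2) S.≈ S.1# S.+ S.1#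
  K2≈1+1 zero    zero    zero    = refl
  K2≈1+1 zero    zero    (suc n) = refl
  K2≈1+1 zero    (suc b) n       = refl
  K2≈1+1 (suc a) b       n       = refl

oneS≈1 : oneS S.≈ S.1#
oneS≈1 zero    zero    zero    = refl
oneS≈1 zero    zero    (suc n) = refl
oneS≈1 zero    (suc b) n       = refl
oneS≈1 (suc a) b       n       = refl

^S≈^ : ∀ f i → (f ^S i) S.≈ f ^ i
^S≈^ f zero    = oneS≈1
^S≈^ f (suc i) = S.trans (⊛-* f (f ^S i)) (S.*-congˡ {f} (^S≈^ f i))

ΣS≤-suc : ∀ d P → ΣS≤ (suc d) P S.≈ P 0 S.+ ΣS≤ d (P ∘ suc)
ΣS≤-suc zero    P a b n = refl
ΣS≤-suc (suc d) P a b n =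
  trans (cong (ℤ._+ P (suc (suc d)) a b n) (ΣS≤-suc d P a b n)) (ℤₚ.+-assoc (P 0 a b n) _ _)

ΣS≤≈Σ≤ᴿ : ∀ d {P Q} → (∀ i → P i S.≈ Q i) → ΣS≤ d P S.≈ Σ≤ᴿ d Q
ΣS≤≈Σ≤ᴿ zero    e = e 0
ΣS≤≈Σ≤ᴿ (suc d) {P} e a b n =
  trans (ΣS≤-suc d P a b n) (cong₂ ℤ._+_ (e 0 a b n) (ΣS≤≈Σ≤ᴿ d (e ∘ suc) a b n))

-- At `t`-degree 0 the part `t S` contributes nothing, and the diagonal coefficient of `θ ^ N` is
-- positive.
leading≢0 : ∀ {P} N S → P S.≈ θ ^ N S.+ t S.* S → P N N 0 ≢ + 0
leading≢0 N S e P≡0 with k , p ← θ^-coefficient N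
  with () ← trans (sym P≡0) (trans (e N N 0) (cong₂ ℤ._+_ p (t-* S N N 0)))

SumOfRoots⇒IsAlgebraic : ∀ {F} → SumOfRoots F → IsAlgebraic F
SumOfRoots⇒IsAlgebraic {F} r
  with d , N , P , poly , (S , lead) , eq ← equation r =
  d , P , (λ i _ → poly i) , (d , N , N , 0 , ℕₚ.≤-refl , leading≢0 N S lead) ,
  λ a b n → trans (ΣS≤≈Σ≤ᴿ d (λ i → S.trans (⊛-* (P i) (F ^S i))
    (S.*-congˡ {P i} (^S≈^ F i))) a b n) (eq a b n)

theorem3p4 : IsAlgebraic bridgeGF
theorem3p4 = SumOfRoots⇒IsAlgebraic sumOfRoots-bridgeGF
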